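{- Let $k\ge1$, let $\mathbf n=(n_1,\dots,n_k)$ be positive integers with $n=\sum_{i=1}^k n_i$, and let $q\ge 0$, $m\ge0$ be integers. Let $Q(\mathbf n;q;m)$ be the number of words containing exactly $n_i$ copies of letter $i$ ($1\le i\le k$) such that $l_m\le q$, where $l_m$ is the length of the $(m+1)$-th longest run when the lengths of all runs (of all letters) are sorted together. In the sums below write $p=\sum_{i=1}^k p_i$ and $j=\sum_{i=1}^k j_i$. (a) If $q>0$, then $$Q(\mathbf n;q;m)=(-1)^{n+m}\sum_{p_1=1}^{n_1}\cdots\sum_{p_k=1}^{n_k}(-1)^p\frac{p!}{p_1!\cdots p_k!}\sum_{j_1,\dots,j_k}(-1)^{j(q+1)}\binom{j-1}{m}\prod_{i=1}^k\binom{n_i-qj_i-1}{p_i-1}\binom{p_i}{n_i-qj_i-j_i},$$ where for each $i$ the index $j_i$ runs over the integers with $\lceil (n_i-p_i)/(q+1)\rceil\le j_i\le\lfloor (n_i-p_i)/q\rfloor$. (b) If $q=0$ and $m\ge n$, then $Q(\mathbf n;0;m)=\dfrac{n!}{n_1!\cdots n_k!}$. (c) If $q=0$ and $m<n$, then $$Q(\mathbf n;0;m)=(-1)^m\sum_{p_1=1}^{n_1}\cdots\sum_{p_k=1}^{n_k}(-1)^p\binom{n-p-1}{m-p}\frac{p!}{p_1!\cdots p_k!}\prod_{i=1}^k\binom{n_i-1}{p_i-1}.$$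
   Context: Words are finite linear sequences over the alphabet $\{1,\dots,k\}$; copies of the same letter are indistinguishable. A run is a maximal block of consecutive equal letters. If a word has $r$ runs in total, the lengths of all its runs, regardless of letter, are sorted as $l_0\ge l_1\ge\cdots\ge l_{r-1}$, and $l_i=0$ for $i\ge r$. Thus $l_m\le q$ means that at most $m$ runs of the word have length greater than $q$. Convention for binomial coefficients $\binom ab$ with integers $a,b$: $\binom ab=0$ if $b<0$, and $\binom ab=a(a-1)\cdots(a-b+1)/b!$ if $b\ge0$ (so $\binom{ -1}{b}=(-1)^b$ for $b\ge 0$). An empty sum is $0$. -}

module Defs where

open import Data.Fin.Base using (Fin; toℕ)
import Data.Fin.Properties as Fin
open import Data.Integer.Base as ℤ using (ℤ; +_; -[1+_]; 0ℤ; 1ℤ)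
import Data.Integer.Properties as ℤ
open import Data.List.Base using (List; []; _∷_; [_]; length; filter; map; head; drop; allFin; cartesianProductWith)
open import Data.List.NonEmpty.Base as List⁺ using (List⁺; _∷_; _∷⁺_)
import Data.List.Sort as Sort
open import Data.Maybe.Base using (fromMaybe)
open import Data.Nat.Base using (ℕ; zero; suc; pred; _+_; _*_; _∸_; _/_; _!; NonZero)
import Data.Nat.Properties as ℕ
open import Data.Vec.Functional as Vector using (Vector)
import Relation.Binary.Construct.Flip.EqAndOrd as Flip
open import Relation.Binary.PropositionalEquality using (_≡_)
open import Relation.Nullary.Decidable using (Dec; yes; no; _×-dec_)

open import Algebra.Properties.CommutativeMonoid.Sum ℕ.+-0-commutativeMonoid public using () renaming (sum to ∑ℕ)
open import Algebra.Properties.CommutativeMonoid.Sum ℕ.*-1-commutativeMonoid public using () renaming (sum to ∏ℕ)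
open import Algebra.Properties.CommutativeMonoid.Sum ℤ.+-0-commutativeMonoid public using () renaming (sum to ∑ℤ)
open import Algebra.Properties.CommutativeMonoid.Sum ℤ.*-1-commutativeMonoid public using () renaming (sum to ∏ℤ)

Word : ℕ → Set
Word k = List (Fin k)

wordsOfLength : (k N : ℕ) → List (Word k)
wordsOfLength k zero    = [ [] ]
wordsOfLength k (suc N) = cartesianProductWith _∷_ (allFin k) (wordsOfLength k N)

count : ∀ {k} → Fin k → Word k → ℕ
count i w = length (filter (i Fin.≟_) w)

HasContent : ∀ {k} → Vector ℕ k → Word k → Set
HasContent n w = ∀ i → count i w ≡ n i

hasContent? : ∀ {k} (n : Vector ℕ k) (w : Word k) → Dec (HasContent n w)
hasContent? n w = Fin.all? (λ i → count i w ℕ.≟ n i)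

consRun : ∀ {k} → Fin k → List (List⁺ (Fin k)) → List (List⁺ (Fin k))
consRun x []               = [ List⁺.[ x ] ]
consRun x ((y ∷ ys) ∷ rs) with x Fin.≟ y
... | yes _ = (x ∷⁺ (y ∷ ys)) ∷ rs
... | no  _ = List⁺.[ x ] ∷ (y ∷ ys) ∷ rs

runs : ∀ {k} → Word k → List (List⁺ (Fin k))
runs []      = []
runs (x ∷ w) = consRun x (runs w)

open Sort (Flip.decTotalOrder ℕ.≤-decTotalOrder) public
  using () renaming (sort to sortDecreasing; sort-↭ to sortDecreasing-↭; sort-↗ to sortDecreasing-↗)

runLengths : ∀ {k} → Word k → List ℕ
runLengths w = sortDecreasing (map List⁺.length (runs w))

-- Indexed from 0, so that ℓ m w is the length of the (m+1)-th longest
-- run; it is 0 if w has at most m runs.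
ℓ : ∀ {k} → ℕ → Word k → ℕ
ℓ i w = fromMaybe 0 (head (drop i (runLengths w)))

-- A word with content n has length ∑ℕ n, so it suffices to enumerate the
-- words of that length.
Q : ∀ {k} → Vector ℕ k → (q m : ℕ) → ℕ
Q {k} n q m =
  length (filter (λ w → hasContent? n w ×-dec (ℓ m w ℕ.≤? q)) (wordsOfLength k (∑ℕ n)))

-- falling a b = a (a - 1) ⋯ (a - b + 1)
falling : ℤ → ℕ → ℤ
falling a zero    = 1ℤ
falling a (suc b) = falling a b ℤ.* (a ℤ.- + b)

-- The division is exact.
binom : ℤ → ℤ → ℤ
binom a (+ b)    = (falling a b ℤ./ℕ (b !)) {{b ℕ.!≢0}}
binom a -[1+ _ ] = 0ℤ

∏!≢0 : ∀ {k} (p : Vector ℕ k) → NonZero (∏ℕ (λ i → p i !))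
∏!≢0 {zero}  p = _
∏!≢0 {suc k} p =
  ℕ.m*n≢0 _ _ {{Vector.head p ℕ.!≢0}} {{∏!≢0 (Vector.tail p)}}

-- The division is exact.
multinomial : ∀ {k} → Vector ℕ k → ℕ
multinomial p = (∑ℕ p ! / ∏ℕ (λ i → p i !)) {{∏!≢0 p}}

⌈_/_⌉ : (a d : ℕ) .{{_ : NonZero d}} → ℕ
⌈ a / d ⌉ = (a + pred d) / d

⌊_/_⌋ : (a d : ℕ) .{{_ : NonZero d}} → ℕ
⌊ a / d ⌋ = a / d

-- f lo + ⋯ + f hi, which is 0 when hi < lo
∑range : (lo hi : ℕ) → (ℕ → ℤ) → ℤ
∑range lo hi f = ∑ℤ {suc hi ∸ lo} (λ i → f (lo + toℕ i))

-- Sum over all p : Vector ℕ k such that lo i ≤ p i ≤ hi i for every i.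
∑box : ∀ {k} → (lo hi : Vector ℕ k) → (Vector ℕ k → ℤ) → ℤ
∑box {zero}  lo hi f = f Vector.[]
∑box {suc k} lo hi f =
  ∑range (Vector.head lo) (Vector.head hi) λ x →
    ∑box (Vector.tail lo) (Vector.tail hi) λ p → f (x Vector.∷ p)

{-# OPTIONS --safe #-}
-- Let y = 1 + z mark the runs of length greater than q, and let V be the
-- sum of y^(number of such runs) over the words with a given content, Vᵢ
-- its restriction to the words starting with the letter i.  Prepending i
-- to a word w creates a new long run exactly when w starts with a run of i
-- of length q, so in generating functions
--   (1 + z xᵢ^(q+1)) Vᵢ = (xᵢ + z xᵢ^(q+1)) V,    V = 1 + ∑ᵢ Vᵢ.
-- With gᵢ = (xᵢ + z xᵢ^(q+1)) / (1 + z xᵢ^(q+1)), the series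
-- ∑ₚ multinomial(p) ∏ᵢ gᵢ^pᵢ solves the same equations, because
-- multinomial(p) = ∑ᵢ multinomial(p - eᵢ).
--
-- A power z^j is never handled as such: it acts on sequences c : ℕ → ℤ as
-- the j-fold shift followed by evaluation at 0.  Choosing c suitably, this
-- turns y^t = (1 + z)^t into the indicator of t ≤ m.
module Submission where

open import Defs
open import Data.Bool.Base using (if_then_else_; true; false)
open import Data.Fin.Base using (Fin; zero; suc; toℕ)
import Data.Fin.Properties as Fin
open import Data.Integer.Base as ℤ using (ℤ; +_; -[1+_]; -1ℤ; 0ℤ; 1ℤ; _-_; _^_)
import Data.Integer.DivMod as ℤ
import Data.Integer.Properties as ℤ
open import Data.Integer.Tactic.RingSolver using (solve-∀)
open import Data.List.Base as List using (List; []; _∷_; _++_; length; filter; map; drop; tabulate; cartesianProductWith)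
open import Data.List.NonEmpty.Base as List⁺ using (_∷_)
import Data.List.Properties as List
open import Data.List.Relation.Binary.Permutation.Propositional.Properties using (filter-↭; ↭-length)
open import Data.List.Relation.Unary.All as All using (All; []; _∷_)
open import Data.List.Relation.Unary.AllPairs using (AllPairs; []; _∷_)
open import Data.List.Relation.Unary.Linked.Properties using (Linked⇒AllPairs)
open import Data.Maybe.Base using (fromMaybe)
open import Data.Nat.Base using (ℕ; zero; suc; _+_; _*_; _∸_; _≤_; _<_; _!; z≤n; s≤s; s≤s⁻¹; NonZero)
open import Data.Nat.Combinatorics using (_C_; nCk+nC[k+1]≡[n+1]C[k+1]; k>n⇒nCk≡0; k![n∸k]!∣n!)
open import Data.Nat.Divisibility using (_∣_; ∣-trans; *-monoʳ-∣; ∣-refl)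
open import Data.Nat.DivMod using (m/n*n≡m; m*n/n≡m; /-monoˡ-≤; m<n*o⇒m/o<n; m/n≤m; m/n*n≤m)
open import Data.Nat.Induction using (<-rec)
import Data.Nat.Properties as ℕ
open import Data.Product.Base using (_×_; _,_; ∃; ∃₂; proj₁; proj₂)
open import Data.Sum.Base using (_⊎_; inj₁; inj₂)
open import Data.Vec.Functional as Vector using (Vector; head; tail)
open import Function.Base using (_∘_; flip)
open import Function.Bundles using (_⇔_; mk⇔; Equivalence)
open import Level using (0ℓ)
open import Relation.Binary.PropositionalEquality using (_≡_; _≢_; _≗_; refl; sym; trans; cong; cong₂; subst; subst₂; module ≡-Reasoning)
open import Relation.Nullary.Decidable using (Dec; yes; no; does; dec-true; dec-false; _×-dec_; does-⇔)
open import Relation.Nullary.Negation using (contradiction; ¬_)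
open import Relation.Unary using (Decidable; Pred)
open import Algebra.Properties.CommutativeMonoid.Sum ℤ.+-0-commutativeMonoid
  using (sum-cong-≗; ∑-distrib-+; sum-replicate-zero; sum-remove)
open import Algebra.Properties.CommutativeMonoid.Sum ℤ.*-1-commutativeMonoid
  using () renaming (∑-distrib-+ to ∏-distrib-*; sum-cong-≗ to ∏-cong)
open import Algebra.Properties.CommutativeMonoid.Sum ℕ.+-0-commutativeMonoid
  using () renaming (sum-remove to ∑ℕ-remove; sum-cong-≗ to ∑ℕ-cong)
open import Algebra.Properties.CommutativeMonoid.Sum ℕ.*-1-commutativeMonoid
  using () renaming (sum-remove to ∏ℕ-remove; sum-cong-≗ to ∏ℕ-cong)
open import Algebra.Properties.Semiring.Sum ℤ.+-*-semiring using (*-distribʳ-sum)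
open import Algebra.Properties.CommutativeSemigroup ℕ.+-commutativeSemigroup using (interchange)
open ≡-Reasoning

-- With u = z x^(q+1) the series is g = (x + u) / (1 + u). In gᵖ, taking x from M of the p numerator
-- factors gives `p C M`, and 1 / (1 + u)ᵖ then supplies u^(j-p+M) with coefficient (-1)^(j-p+M)
-- binom(M+j-1, p-1). The product is `β`. The quotient is never expanded: only the recurrence (1 +
-- u) gᵖ⁺¹ = (x + u) gᵖ is checked. The values of `threshold` come from binomial inversion:
-- requiring ∑ⱼ (t C j) c j = [t ≤ m] for all t forces c j = ∑ (-1)^(j-t) (j C t) over t ≤ m, which
-- is (-1)^(j+m) binom(j-1, m); at j = 0 this is 1, because binom(-1, m) = (-1)^m. The equations for
-- V and Vᵢ determine the coefficients degree by degree, so words and series are compared by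
-- induction on the length. For q = 0 the upper bound on j has no meaning. There g = x (1 + z) / (1
-- + z x), so gᵖ carries a factor (1 + z)ᵖ, and its action on `threshold` evaluates the sum over j
-- in closed form.

-- Finite sums of integers

∑-*ʳ : ∀ {k} c (f : Vector ℤ k) → ∑ℤ f ℤ.* c ≡ ∑ℤ (λ i → f i ℤ.* c)
∑-*ʳ c f = *-distribʳ-sum c f

∑< : ℕ → (ℕ → ℤ) → ℤ
∑< zero    f = 0ℤ
∑< (suc B) f = f 0 ℤ.+ ∑< B (f ∘ suc)

∑<≡∑ : ∀ B f → ∑< B f ≡ ∑ℤ {B} (λ i → f (toℕ i))
∑<≡∑ zero    f = refl
∑<≡∑ (suc B) f = cong (ℤ._+_ (f 0)) (∑<≡∑ B (f ∘ suc))

∑<-cong : ∀ B {f g : ℕ → ℤ} → (∀ x → x < B → f x ≡ g x) → ∑< B f ≡ ∑< B g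
∑<-cong zero    f≗g = refl
∑<-cong (suc B) f≗g = cong₂ ℤ._+_ (f≗g 0 (s≤s z≤n)) (∑<-cong B (λ x x<B → f≗g (suc x) (s≤s x<B)))

∑<-zero : ∀ B {f : ℕ → ℤ} → (∀ x → x < B → f x ≡ 0ℤ) → ∑< B f ≡ 0ℤ
∑<-zero zero    f≗0 = refl
∑<-zero (suc B) f≗0 = cong₂ ℤ._+_ (f≗0 0 (s≤s z≤n)) (∑<-zero B (λ x x<B → f≗0 (suc x) (s≤s x<B)))

∑<-+ : ∀ B (f g : ℕ → ℤ) → ∑< B (λ x → f x ℤ.+ g x) ≡ ∑< B f ℤ.+ ∑< B g
∑<-+ zero    f g = refl
∑<-+ (suc B) f g = trans (cong (ℤ._+_ (f 0 ℤ.+ g 0)) (∑<-+ B (f ∘ suc) (g ∘ suc)))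
  (ℤ-interchange (f 0) (g 0) (∑< B (f ∘ suc)) (∑< B (g ∘ suc)))
  where
  ℤ-interchange : ∀ w x y z → w ℤ.+ x ℤ.+ (y ℤ.+ z) ≡ w ℤ.+ y ℤ.+ (x ℤ.+ z)
  ℤ-interchange = solve-∀

∑<-*ˡ : ∀ B c (f : ℕ → ℤ) → c ℤ.* ∑< B f ≡ ∑< B (λ x → c ℤ.* f x)
∑<-*ˡ zero    c f = ℤ.*-zeroʳ c
∑<-*ˡ (suc B) c f = trans (ℤ.*-distribˡ-+ c (f 0) (∑< B (f ∘ suc)))
  (cong (ℤ._+_ (c ℤ.* f 0)) (∑<-*ˡ B c (f ∘ suc)))

∑<-snoc : ∀ B (f : ℕ → ℤ) → ∑< (suc B) f ≡ ∑< B f ℤ.+ f B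
∑<-snoc zero    f = ℤ.+-comm (f 0) 0ℤ
∑<-snoc (suc B) f =
  trans (cong (ℤ._+_ (f 0)) (∑<-snoc B (f ∘ suc))) (sym (ℤ.+-assoc (f 0) _ _))

∑<-cons : ∀ B (f : ℕ → ℤ) → f B ≡ 0ℤ → ∑< B f ≡ f 0 ℤ.+ ∑< B (f ∘ suc)
∑<-cons B f fB≡0 = begin
  ∑< B f             ≡⟨ ℤ.+-identityʳ _ ⟨
  ∑< B f ℤ.+ 0ℤ      ≡⟨ cong (ℤ._+_ (∑< B f)) fB≡0 ⟨
  ∑< B f ℤ.+ f B     ≡⟨ ∑<-snoc B f ⟨
  ∑< (suc B) f       ∎

∑<-split : ∀ a b (f : ℕ → ℤ) → ∑< (a + b) f ≡ ∑< a f ℤ.+ ∑< b (λ x → f (a + x))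
∑<-split zero    b f = sym (ℤ.+-identityˡ _)
∑<-split (suc a) b f =
  trans (cong (ℤ._+_ (f 0)) (∑<-split a b (f ∘ suc))) (sym (ℤ.+-assoc (f 0) _ _))

∑<-range : ∀ B lo hi (f : ℕ → ℤ) → hi < B → (∀ x → x < lo → f x ≡ 0ℤ) →
           (∀ x → hi < x → f x ≡ 0ℤ) → ∑< B f ≡ ∑< (suc hi ∸ lo) (λ x → f (lo + x))
∑<-range B lo hi f hi<B below above with lo ℕ.≤? suc hi
... | no lo≰1+hi = trans (∑<-zero B outside) (sym empty)
  where
  outside : ∀ x → x < B → f x ≡ 0ℤ
  outside x _ with x ℕ.<? lo
  ... | yes x<lo = below x x<lo
  ... | no  x≮lo = above x (ℕ.<-trans (ℕ.n<1+n hi) (ℕ.<-≤-trans (ℕ.≰⇒> lo≰1+hi) (ℕ.≮⇒≥ x≮lo)))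
  empty : ∑< (suc hi ∸ lo) (λ x → f (lo + x)) ≡ 0ℤ
  empty = cong (λ d → ∑< d (λ x → f (lo + x))) (ℕ.m≤n⇒m∸n≡0 (ℕ.<⇒≤ (ℕ.≰⇒> lo≰1+hi)))
... | yes lo≤1+hi = begin
  ∑< B f
    ≡⟨ cong (λ b → ∑< b f) B≡ ⟨
  ∑< (suc hi + e) f
    ≡⟨ ∑<-split (suc hi) e f ⟩
  ∑< (suc hi) f ℤ.+ ∑< e (λ x → f (suc hi + x))
    ≡⟨ cong (ℤ._+_ (∑< (suc hi) f)) (∑<-zero e (λ x _ → above (suc hi + x) (ℕ.m≤m+n (suc hi) x))) ⟩
  ∑< (suc hi) f ℤ.+ 0ℤ
    ≡⟨ ℤ.+-identityʳ _ ⟩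
  ∑< (suc hi) f
    ≡⟨ cong (λ b → ∑< b f) (ℕ.m+[n∸m]≡n lo≤1+hi) ⟨
  ∑< (lo + (suc hi ∸ lo)) f
    ≡⟨ ∑<-split lo (suc hi ∸ lo) f ⟩
  ∑< lo f ℤ.+ ∑< d (λ x → f (lo + x))
    ≡⟨ cong (ℤ._+ ∑< d (λ x → f (lo + x))) (∑<-zero lo below) ⟩
  0ℤ ℤ.+ ∑< d (λ x → f (lo + x))
    ≡⟨ ℤ.+-identityˡ _ ⟩
  ∑< d (λ x → f (lo + x)) ∎
  where
  d e : ℕ
  d = suc hi ∸ lo
  e = B ∸ suc hi
  B≡ : suc hi + e ≡ B
  B≡ = ℕ.m+[n∸m]≡n hi<B

∑<-∑range : ∀ B lo hi (f : ℕ → ℤ) → hi < B → (∀ x → x < lo → f x ≡ 0ℤ) →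
            (∀ x → hi < x → f x ≡ 0ℤ) → ∑< B f ≡ ∑range lo hi f
∑<-∑range B lo hi f hi<B below above =
  trans (∑<-range B lo hi f hi<B below above) (∑<≡∑ (suc hi ∸ lo) (λ x → f (lo + x)))

∑-pos : ∀ {k} (n : Vector ℕ k) → ∑ℤ (λ i → + n i) ≡ + ∑ℕ n
∑-pos {zero}  n = refl
∑-pos {suc k} n = cong (ℤ._+_ (+ n zero)) (∑-pos (tail n))

-- Multiplication by powers of a variable

-- shift r f is the coefficient sequence of xʳ ∑ₙ f n xⁿ.
shift : ℕ → (ℕ → ℤ) → ℕ → ℤ
shift zero    f n       = f n
shift (suc r) f zero    = 0ℤ
shift (suc r) f (suc n) = shift r f n

-- δ i r does the same in the i-th of k variables.
δ : ∀ {k} → Fin k → ℕ → (Vector ℕ k → ℤ) → Vector ℕ k → ℤ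
δ zero    r Φ n = shift r (λ a → Φ (a Vector.∷ tail n)) (head n)
δ (suc i) r Φ n = δ i r (λ t → Φ (head n Vector.∷ t)) (tail n)

shift-view : ∀ r n → (n < r × (∀ f → shift r f n ≡ 0ℤ))
                   ⊎ ∃ λ n′ → n ≡ r + n′ × (∀ f → shift r f n ≡ f n′)
shift-view zero    n       = inj₂ (n , refl , λ _ → refl)
shift-view (suc r) zero    = inj₁ (s≤s z≤n , λ _ → refl)
shift-view (suc r) (suc n) with shift-view r n
... | inj₁ (n<r , z)       = inj₁ (s≤s n<r , z)
... | inj₂ (n′ , refl , s) = inj₂ (n′ , refl , s)

shift-shift : ∀ r s f n → shift r (shift s f) n ≡ shift (r + s) f n
shift-shift zero    s f n       = refl
shift-shift (suc r) s f zero    = refl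
shift-shift (suc r) s f (suc n) = shift-shift r s f n

-- The relation n = n′ + r eᵢ, kept pointwise because vectors are functions and equality of
-- functions is not at hand.
record Reduct {k} (i : Fin k) (r : ℕ) (n n′ : Vector ℕ k) : Set where
  field
    here  : n i ≡ r + n′ i
    there : ∀ j → j ≢ i → n j ≡ n′ j

-- The alternative depends on `n` alone and not on `Φ`. A single case split therefore turns several
-- shifts at the same place into evaluations at the same `n′`, which yields linearity and congruence
-- of `δ`.
δ-view : ∀ {k} (i : Fin k) r (n : Vector ℕ k) →
         (n i < r × (∀ Φ → δ i r Φ n ≡ 0ℤ))
         ⊎ ∃ λ n′ → Reduct i r n n′ × (∀ Φ → δ i r Φ n ≡ Φ n′)
δ-view zero r n with shift-view r (head n)
... | inj₁ (n<r , z)    = inj₁ (n<r , λ Φ → z _)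
... | inj₂ (a , eq , s) = inj₂ (a Vector.∷ tail n , record { here = eq ; there = there } , λ Φ → s _)
  where
  there : ∀ j → j ≢ zero → n j ≡ (a Vector.∷ tail n) j
  there zero    j≢ = contradiction refl j≢
  there (suc j) j≢ = refl
δ-view (suc i) r n with δ-view i r (tail n)
... | inj₁ (n<r , z)      = inj₁ (n<r , λ Φ → z _)
... | inj₂ (t , red , s) =
  inj₂ (head n Vector.∷ t , record { here = Reduct.here red ; there = there } , λ Φ → s _)
  where
  there : ∀ j → j ≢ suc i → n j ≡ (head n Vector.∷ t) j
  there zero    j≢ = refl
  there (suc j) j≢ = Reduct.there red j (λ j≡i → j≢ (cong suc j≡i))

module _ {k} {i : Fin k} {r : ℕ} {n n′ : Vector ℕ k} (red : Reduct i r n n′) where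
  open Reduct red

  reduct-∑ : ∑ℕ n ≡ r + ∑ℕ n′
  reduct-∑ = helper k i n n′ here there
    where
    helper : ∀ k (i : Fin k) (n n′ : Vector ℕ k) → n i ≡ r + n′ i →
             (∀ j → j ≢ i → n j ≡ n′ j) → ∑ℕ n ≡ r + ∑ℕ n′
    helper (suc k) i n n′ here there = begin
      ∑ℕ n                                      ≡⟨ ∑ℕ-remove {i = i} n ⟩
      n i + ∑ℕ (Vector.removeAt n i)
        ≡⟨ cong₂ _+_ here (∑ℕ-cong (λ j → there _ (Fin.punchInᵢ≢i i j))) ⟩
      r + n′ i + ∑ℕ (Vector.removeAt n′ i)      ≡⟨ ℕ.+-assoc r _ _ ⟩
      r + (n′ i + ∑ℕ (Vector.removeAt n′ i))    ≡⟨ cong (_+_ r) (∑ℕ-remove {i = i} n′) ⟨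
      r + ∑ℕ n′                                 ∎

reduct-∏! : ∀ {k} {i : Fin k} {n n′ : Vector ℕ k} → Reduct i 1 n n′ →
            ∏ℕ (λ j → n j !) ≡ n i * ∏ℕ (λ j → n′ j !)
reduct-∏! {suc k} {i} {n} {n′} red = begin
  ∏ℕ (λ j → n j !)                                      ≡⟨ ∏ℕ-remove {i = i} (λ j → n j !) ⟩
  n i ! * ∏ℕ (Vector.removeAt (λ j → n j !) i)
    ≡⟨ cong₂ _*_ (cong _! here) (∏ℕ-cong (λ j → cong _! (there _ (Fin.punchInᵢ≢i i j)))) ⟩
  suc (n′ i) * n′ i ! * ∏ℕ (Vector.removeAt (λ j → n′ j !) i)  ≡⟨ ℕ.*-assoc (suc (n′ i)) (n′ i !) _ ⟩
  suc (n′ i) * (n′ i ! * ∏ℕ (Vector.removeAt (λ j → n′ j !) i))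
    ≡⟨ cong₂ _*_ here (∏ℕ-remove {i = i} (λ j → n′ j !)) ⟨
  n i * ∏ℕ (λ j → n′ j !)                               ∎
  where open Reduct red

-- Multinomial coefficients

∏!∣∑! : ∀ {k} (n : Vector ℕ k) → ∏ℕ (λ i → n i !) ∣ ∑ℕ n !
∏!∣∑! {zero}  n = ∣-refl
∏!∣∑! {suc k} n = ∣-trans (*-monoʳ-∣ (head n !) (∏!∣∑! (tail n))) m!*n!∣[m+n]!
  where
  m!*n!∣[m+n]! : head n ! * ∑ℕ (tail n) ! ∣ (head n + ∑ℕ (tail n)) !
  m!*n!∣[m+n]! = subst (λ d → head n ! * d ! ∣ (head n + ∑ℕ (tail n)) !)
    (ℕ.m+n∸m≡n (head n) _) (k![n∸k]!∣n! (ℕ.m≤m+n (head n) _))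

multinomial-∏! : ∀ {k} (n : Vector ℕ k) → multinomial n * ∏ℕ (λ i → n i !) ≡ ∑ℕ n !
multinomial-∏! n = m/n*n≡m {{∏!≢0 n}} (∏!∣∑! n)

multinomialℤ : ∀ {k} → Vector ℕ k → ℤ
multinomialℤ p = + multinomial p

-- After multiplication by ∏ nᵢ! the i-th term on the right becomes nᵢ S!, and these add up to (S +
-- 1) S!. A component nᵢ = 0 gives 0 on both readings.
multinomial-rec : ∀ {k} (n : Vector ℕ k) {S} → ∑ℕ n ≡ suc S →
                  + multinomial n ≡ ∑ℤ (λ i → δ i 1 multinomialℤ n)
multinomial-rec n {S} ∑n≡ = ℤ.*-cancelʳ-≡ _ _ (+ P) {{∏!≢0 n}} (begin
  + multinomial n ℤ.* + P                        ≡⟨ ℤ.pos-* (multinomial n) P ⟨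
  + (multinomial n * P)                          ≡⟨ cong +_ (multinomial-∏! n) ⟩
  + (∑ℕ n !)                                     ≡⟨ cong (λ s → + (s !)) ∑n≡ ⟩
  + (suc S * S !)                                ≡⟨ ℤ.pos-* (suc S) _ ⟩
  + suc S ℤ.* + (S !)                            ≡⟨ cong (λ s → + s ℤ.* + (S !)) ∑n≡ ⟨
  + ∑ℕ n ℤ.* + (S !)                             ≡⟨ cong (ℤ._* + (S !)) (∑-pos n) ⟨
  ∑ℤ (λ i → + n i) ℤ.* + (S !)                   ≡⟨ ∑-*ʳ (+ (S !)) (λ i → + n i) ⟩
  ∑ℤ (λ i → + n i ℤ.* + (S !))                   ≡⟨ sum-cong-≗ term ⟨
  ∑ℤ (λ i → δ i 1 multinomialℤ n ℤ.* + P) ≡⟨ ∑-*ʳ (+ P) (λ i → δ i 1 multinomialℤ n) ⟨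
  ∑ℤ (λ i → δ i 1 multinomialℤ n) ℤ.* + P ∎)
  where
  P : ℕ
  P = ∏ℕ (λ i → n i !)
  term : ∀ i → δ i 1 multinomialℤ n ℤ.* + P ≡ + n i ℤ.* + (S !)
  term i with δ-view i 1 n
  ... | inj₁ (n<1 , z) rewrite z multinomialℤ | ℕ.n<1⇒n≡0 n<1 = refl
  ... | inj₂ (n′ , red , s) = begin
    δ i 1 multinomialℤ n ℤ.* + P       ≡⟨ cong (ℤ._* + P) (s _) ⟩
    + multinomial n′ ℤ.* + P                      ≡⟨ ℤ.pos-* (multinomial n′) P ⟨
    + (multinomial n′ * P)                        ≡⟨ cong (λ d → + (multinomial n′ * d)) (reduct-∏! red) ⟩
    + (multinomial n′ * (n i * P′))               ≡⟨ cong +_ (x*[y*z]≡y*[x*z] (multinomial n′) (n i) P′) ⟩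
    + (n i * (multinomial n′ * P′))               ≡⟨ cong (λ d → + (n i * d)) (multinomial-∏! n′) ⟩
    + (n i * (∑ℕ n′ !))                           ≡⟨ cong (λ d → + (n i * (d !))) ∑n′≡S ⟩
    + (n i * (S !))                               ≡⟨ ℤ.pos-* (n i) _ ⟩
    + n i ℤ.* + (S !)                             ∎
    where
    P′ : ℕ
    P′ = ∏ℕ (λ j → n′ j !)
    ∑n′≡S : ∑ℕ n′ ≡ S
    ∑n′≡S = ℕ.suc-injective (trans (sym (reduct-∑ red)) ∑n≡)
    x*[y*z]≡y*[x*z] : ∀ x y z → x * (y * z) ≡ y * (x * z)
    x*[y*z]≡y*[x*z] x y z = trans (sym (ℕ.*-assoc x y z)) (trans (cong (_* z) (ℕ.*-comm x y)) (ℕ.*-assoc y x z))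

-- Closed form of the coefficients of gᵖ

C-suc : ∀ n k → suc n C suc k ≡ n C k + n C suc k
C-suc n k = sym (nCk+nC[k+1]≡[n+1]C[k+1] n k)

C-0 : ∀ n → n C 0 ≡ 1
C-0 zero    = refl
C-0 (suc n) = refl

-- The number of compositions of N into p positive parts, equal to
-- binom (N - 1) (p - 1) for N, p > 0.
κ : ℕ → ℕ → ℕ
κ zero    zero    = 1
κ zero    (suc p) = 0
κ (suc N) zero    = 0
κ (suc N) (suc p) = N C p

κ-suc : ∀ N p → κ (suc N) (suc p) ≡ κ N (suc p) + κ N p
κ-suc zero    zero    = refl
κ-suc zero    (suc p) = k>n⇒nCk≡0 {0} {suc p} (s≤s z≤n)
κ-suc (suc N) zero    = sym (ℕ.+-identityʳ _)
κ-suc (suc N) (suc p) = trans (C-suc N p) (ℕ.+-comm (N C p) _)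

κ-big : ∀ {N p} → N < p → κ N p ≡ 0
κ-big {zero}  {suc p} _         = refl
κ-big {suc N} {suc p} (s≤s N<p) = k>n⇒nCk≡0 N<p

C*C≡0 : ∀ M p → (M C p) * (p C suc M) ≡ 0
C*C≡0 M p with p ℕ.≤? M
... | yes p≤M = trans (cong ((M C p) *_) (k>n⇒nCk≡0 (s≤s p≤M))) (ℕ.*-zeroʳ (M C p))
... | no  p≰M = cong (_* (p C suc M)) (k>n⇒nCk≡0 (ℕ.≰⇒> p≰M))

-- Both sides vanish unless p = M, where both are 1: at z = 0 the series g is just x.
κ*C-suc : ∀ M p → κ (suc M) (suc p) * (suc p C suc M) ≡ κ M p * (p C M)
κ*C-suc M p = begin
  (M C p) * (suc p C suc M)                        ≡⟨ cong ((M C p) *_) (C-suc p M) ⟩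
  (M C p) * (p C M + p C suc M)                    ≡⟨ ℕ.*-distribˡ-+ (M C p) _ _ ⟩
  (M C p) * (p C M) + (M C p) * (p C suc M)          ≡⟨ cong (_+_ ((M C p) * (p C M))) (C*C≡0 M p) ⟩
  (M C p) * (p C M) + 0                            ≡⟨ ℕ.+-identityʳ _ ⟩
  (M C p) * (p C M)                                ≡⟨ diagonal M p ⟩
  κ M p * (p C M)                                ∎
  where
  diagonal : ∀ M p → (M C p) * (p C M) ≡ κ M p * (p C M)
  diagonal zero    zero    = refl
  diagonal zero    (suc p) = cong (_* (suc p C 0)) (k>n⇒nCk≡0 {0} {suc p} (s≤s z≤n))
  diagonal (suc M) zero    = trans (cong ((suc M C 0) *_) C≡0) (ℕ.*-zeroʳ (suc M C 0))
    where
    C≡0 : 0 C suc M ≡ 0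
    C≡0 = k>n⇒nCk≡0 {0} {suc M} (s≤s z≤n)
  diagonal (suc M) (suc p) = begin
    (suc M C suc p) * (suc p C suc M)
      ≡⟨ cong (_* (suc p C suc M)) (C-suc M p) ⟩
    (M C p + M C suc p) * (suc p C suc M)
      ≡⟨ ℕ.*-distribʳ-+ (suc p C suc M) (M C p) _ ⟩
    (M C p) * (suc p C suc M) + (M C suc p) * (suc p C suc M)
      ≡⟨ cong (_+_ ((M C p) * (suc p C suc M))) (C*C≡0 M (suc p)) ⟩
    (M C p) * (suc p C suc M) + 0
      ≡⟨ ℕ.+-identityʳ _ ⟩
    (M C p) * (suc p C suc M) ∎

-- β M p j is the coefficient of xⁿ zʲ in gᵖ, where n = (q + 1) j + M.
β : ℕ → ℕ → ℕ → ℤ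
β M p j = -1ℤ ^ (M + j + p) ℤ.* + (κ (M + j) p * (p C M))

-1*[-1*] : ∀ s → -1ℤ ℤ.* (-1ℤ ℤ.* s) ≡ s
-1*[-1*] s = trans (sym (ℤ.*-assoc -1ℤ -1ℤ s)) (ℤ.*-identityˡ s)

β-suc-0 : ∀ M p → β M (suc p) 0 ≡ shift 1 (λ M′ → β M′ p 0) M
β-suc-0 zero    p = ℤ.*-zeroʳ (-1ℤ ^ suc p)
β-suc-0 (suc M) p rewrite ℕ.+-identityʳ M | ℕ.+-suc M p | κ*C-suc M p =
  cong (ℤ._* + (κ M p * (p C M))) (-1*[-1*] (-1ℤ ^ (M + p)))

-- The coefficient of x^M u^(j+1) in (1 + u) gᵖ⁺¹ = (x + u) gᵖ. On the left, Pascal's rule for `κ`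
-- produces a term with `suc p` parts that cancels the second summand; Pascal's rule for `C` splits
-- what remains into the two terms on the right.
β-suc-suc : ∀ M p j → β M (suc p) (suc j) ℤ.+ β M (suc p) j
                    ≡ shift 1 (λ M′ → β M′ p (suc j)) M ℤ.+ β M p j
β-suc-suc zero p j rewrite C-0 p | ℕ.*-identityʳ (κ (suc j) (suc p)) | ℕ.*-identityʳ (κ j (suc p)) | ℕ.*-identityʳ (κ j p)
                         | κ-suc j p | ℕ.+-suc j p = begin
  -1ℤ ℤ.* (-1ℤ ℤ.* s) ℤ.* + (x + y) ℤ.+ -1ℤ ℤ.* s ℤ.* + x
    ≡⟨ cong (λ e → -1ℤ ℤ.* (-1ℤ ℤ.* s) ℤ.* e ℤ.+ -1ℤ ℤ.* s ℤ.* + x) (ℤ.pos-+ x y) ⟩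
  -1ℤ ℤ.* (-1ℤ ℤ.* s) ℤ.* (+ x ℤ.+ + y) ℤ.+ -1ℤ ℤ.* s ℤ.* + x
    ≡⟨ signs s (+ x) (+ y) ⟩
  0ℤ ℤ.+ s ℤ.* + y ∎
  where
  s = -1ℤ ^ (j + p)
  x = κ j (suc p)
  y = κ j p
  signs : ∀ s x y → -1ℤ ℤ.* (-1ℤ ℤ.* s) ℤ.* (x ℤ.+ y) ℤ.+ -1ℤ ℤ.* s ℤ.* x ≡ 0ℤ ℤ.+ s ℤ.* y
  signs = solve-∀
β-suc-suc (suc M) p j rewrite ℕ.+-suc M j | ℕ.+-suc (M + j) p | κ-suc (suc (M + j)) p | C-suc p M = begin
  -1ℤ ℤ.* (-1ℤ ℤ.* (-1ℤ ℤ.* s)) ℤ.* + ((x + y) * (u + v)) ℤ.+ -1ℤ ℤ.* (-1ℤ ℤ.* s) ℤ.* + (x * (u + v))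
    ≡⟨ cong₂ (λ d e → -1ℤ ℤ.* (-1ℤ ℤ.* (-1ℤ ℤ.* s)) ℤ.* d ℤ.+ -1ℤ ℤ.* (-1ℤ ℤ.* s) ℤ.* e) (ℤ.pos-* (x + y) (u + v)) (ℤ.pos-* x (u + v)) ⟩
  -1ℤ ℤ.* (-1ℤ ℤ.* (-1ℤ ℤ.* s)) ℤ.* ((+ x ℤ.+ + y) ℤ.* (+ u ℤ.+ + v)) ℤ.+ -1ℤ ℤ.* (-1ℤ ℤ.* s) ℤ.* (+ x ℤ.* (+ u ℤ.+ + v))
    ≡⟨ signs s (+ x) (+ y) (+ u) (+ v) ⟩
  -1ℤ ℤ.* s ℤ.* (+ y ℤ.* + u) ℤ.+ -1ℤ ℤ.* s ℤ.* (+ y ℤ.* + v)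
    ≡⟨ cong₂ (λ d e → -1ℤ ℤ.* s ℤ.* d ℤ.+ -1ℤ ℤ.* s ℤ.* e) (ℤ.pos-* y u) (ℤ.pos-* y v) ⟨
  -1ℤ ℤ.* s ℤ.* + (y * u) ℤ.+ -1ℤ ℤ.* s ℤ.* + (y * v) ∎
  where
  s = -1ℤ ^ (M + j + p)
  x = κ (suc (M + j)) (suc p)
  y = κ (suc (M + j)) p
  u = p C M
  v = p C suc M
  signs : ∀ s x y u v →
    -1ℤ ℤ.* (-1ℤ ℤ.* (-1ℤ ℤ.* s)) ℤ.* ((x ℤ.+ y) ℤ.* (u ℤ.+ v)) ℤ.+ -1ℤ ℤ.* (-1ℤ ℤ.* s) ℤ.* (x ℤ.* (u ℤ.+ v))
    ≡ -1ℤ ℤ.* s ℤ.* (y ℤ.* u) ℤ.+ -1ℤ ℤ.* s ℤ.* (y ℤ.* v)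
  signs = solve-∀

-- Linearity of the shifts

shift-cong : ∀ r n {f g : ℕ → ℤ} → (∀ x → x ≤ n → f x ≡ g x) → shift r f n ≡ shift r g n
shift-cong zero    n       f≗g = f≗g n ℕ.≤-refl
shift-cong (suc r) zero    f≗g = refl
shift-cong (suc r) (suc n) f≗g = shift-cong r n (λ x x≤n → f≗g x (ℕ.m≤n⇒m≤1+n x≤n))

shift-zero : ∀ r n {f : ℕ → ℤ} → (∀ x → n ≡ r + x → f x ≡ 0ℤ) → shift r f n ≡ 0ℤ
shift-zero r n {f} f≗0 with shift-view r n
... | inj₁ (_ , z)         = z f
... | inj₂ (n′ , refl , s) = trans (s f) (f≗0 n′ refl)

shift-+ : ∀ r n (f g : ℕ → ℤ) → shift r (λ x → f x ℤ.+ g x) n ≡ shift r f n ℤ.+ shift r g n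
shift-+ zero    n       f g = refl
shift-+ (suc r) zero    f g = refl
shift-+ (suc r) (suc n) f g = shift-+ r n f g

shift-∑< : ∀ r n B (f : ℕ → ℕ → ℤ) →
           shift r (λ x → ∑< B (f x)) n ≡ ∑< B (λ y → shift r (λ x → f x y) n)
shift-∑< zero    n       B f = refl
shift-∑< (suc r) zero    B f = sym (∑<-zero B (λ _ _ → refl))
shift-∑< (suc r) (suc n) B f = shift-∑< r n B f

shift-*ʳ : ∀ r n (f : ℕ → ℤ) c → shift r (λ x → f x ℤ.* c) n ≡ shift r f n ℤ.* c
shift-*ʳ zero    n       f c = refl
shift-*ʳ (suc r) zero    f c = refl
shift-*ʳ (suc r) (suc n) f c = shift-*ʳ r n f c

δ-lin : ∀ {k} (i : Fin k) r n B (f : ℕ → ℤ) (Φ : ℕ → Vector ℕ k → ℤ) →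
        δ i r (λ p → ∑< B (λ x → f x ℤ.* Φ x p)) n ≡ ∑< B (λ x → f x ℤ.* δ i r (Φ x) n)
δ-lin i r n B f Φ with δ-view i r n
... | inj₂ (n′ , _ , s) =
  trans (s _) (∑<-cong B (λ x _ → cong (f x ℤ.*_) (sym (s (Φ x)))))
... | inj₁ (_ , z) = trans (z _) (sym (∑<-zero B (λ x _ →
  trans (cong (f x ℤ.*_) (z (Φ x))) (ℤ.*-zeroʳ (f x)))))

δ-∑< : ∀ {k} (i : Fin k) r n B (Φ : ℕ → Vector ℕ k → ℤ) →
       δ i r (λ p → ∑< B (λ x → Φ x p)) n ≡ ∑< B (λ x → δ i r (Φ x) n)
δ-∑< i r n B Φ with δ-view i r n
... | inj₂ (n′ , _ , s) = trans (s _) (∑<-cong B (λ x _ → sym (s (Φ x))))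
... | inj₁ (_ , z)      = trans (z _) (sym (∑<-zero B (λ x _ → z (Φ x))))

δ-cong : ∀ {k} (i : Fin k) r n {Φ Ψ : Vector ℕ k → ℤ} → (∀ p → Φ p ≡ Ψ p) → δ i r Φ n ≡ δ i r Ψ n
δ-cong i r n {Φ} {Ψ} Φ≗Ψ with δ-view i r n
... | inj₁ (_ , z)      = trans (z Φ) (sym (z Ψ))
... | inj₂ (n′ , _ , s) = trans (s Φ) (trans (Φ≗Ψ n′) (sym (s Ψ)))

-- Powers of g and the series in several variables

-- The coefficient of xⁿ zʲ in gᵖ: each z brings x^(q+1) with it, and M is the exponent left over.
coeff : ℕ → ℕ → ℕ → ℕ → ℤ
coeff q n p j = shift (j * suc q) (λ M → β M p j) n

module _ (q : ℕ) where

  coeff-suc-0 : ∀ n p → coeff q n (suc p) 0 ≡ shift 1 (λ n′ → coeff q n′ p 0) n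
  coeff-suc-0 n p = β-suc-0 n p

  -- The terms of index j carry an extra shift by q + 1, which lifts their offset j (q + 1) to that
  -- of the terms of index j + 1; at this common offset the identity is `β-suc-suc`.
  coeff-suc-suc : ∀ n p j → coeff q n (suc p) (suc j) ℤ.+ shift (suc q) (λ n′ → coeff q n′ (suc p) j) n
                      ≡ shift 1 (λ n′ → coeff q n′ p (suc j)) n ℤ.+ shift (suc q) (λ n′ → coeff q n′ p j) n
  coeff-suc-suc n p j = begin
    coeff q n (suc p) (suc j) ℤ.+ shift (suc q) (λ n′ → coeff q n′ (suc p) j) n
      ≡⟨ cong (ℤ._+_ (coeff q n (suc p) (suc j))) (shift-shift (suc q) (j * suc q) _ n) ⟩
    shift r (λ M → β M (suc p) (suc j)) n ℤ.+ shift r (λ M → β M (suc p) j) n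
      ≡⟨ shift-+ r n _ _ ⟨
    shift r (λ M → β M (suc p) (suc j) ℤ.+ β M (suc p) j) n
      ≡⟨ shift-cong r n (λ M _ → β-suc-suc M p j) ⟩
    shift r (λ M → shift 1 (λ M′ → β M′ p (suc j)) M ℤ.+ β M p j) n
      ≡⟨ shift-+ r n _ _ ⟩
    shift r (shift 1 (λ M → β M p (suc j))) n ℤ.+ shift r (λ M → β M p j) n
      ≡⟨ cong₂ ℤ._+_ swap (sym (shift-shift (suc q) (j * suc q) _ n)) ⟩
    shift 1 (λ n′ → coeff q n′ p (suc j)) n ℤ.+ shift (suc q) (λ n′ → coeff q n′ p j) n ∎
    where
    r : ℕ
    r = suc j * suc q
    swap : shift r (shift 1 (λ M → β M p (suc j))) n ≡ shift 1 (λ n′ → coeff q n′ p (suc j)) n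
    swap = begin
      shift r (shift 1 (λ M → β M p (suc j))) n   ≡⟨ shift-shift r 1 _ n ⟩
      shift (r + 1) (λ M → β M p (suc j)) n       ≡⟨ cong (λ d → shift d (λ M → β M p (suc j)) n) (ℕ.+-comm r 1) ⟩
      shift (1 + r) (λ M → β M p (suc j)) n       ≡⟨ shift-shift 1 r _ n ⟨
      shift 1 (shift r (λ M → β M p (suc j))) n   ∎

  j≤j*[1+q] : ∀ j → j ≤ j * suc q
  j≤j*[1+q] j = ℕ.m≤m*n j (suc q)

  -- Since zʲ comes with at least xʲ, cutting the sums over j at a bound above n loses nothing.
  coeff-big-j : ∀ {n p j} → n < j → coeff q n p j ≡ 0ℤ
  coeff-big-j {n} {p} {j} n<j = shift-zero (j * suc q) n (λ x n≡ →
    contradiction (ℕ.≤-trans (j≤j*[1+q] j) (ℕ.≤-trans (ℕ.m≤m+n _ x) (ℕ.≤-reflexive (sym n≡)))) (ℕ.<⇒≱ n<j))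

  β-big-p : ∀ {M p j} → M + j < p → β M p j ≡ 0ℤ
  β-big-p {M} {p} {j} M+j<p = trans (cong (λ d → -1ℤ ^ (M + j + p) ℤ.* + (d * (p C M))) (κ-big M+j<p)) (ℤ.*-zeroʳ (-1ℤ ^ (M + j + p)))

  -- As g has no constant term in x, gᵖ starts at xᵖ; this justifies cutting the sums over p.
  coeff-big-p : ∀ {n p j} → n < p → coeff q n p j ≡ 0ℤ
  coeff-big-p {n} {p} {j} n<p = shift-zero (j * suc q) n (λ M n≡ → β-big-p {M} {p} {j}
    (ℕ.≤-<-trans (ℕ.≤-trans (ℕ.≤-reflexive (ℕ.+-comm M j)) (ℕ.≤-trans (ℕ.+-monoˡ-≤ M (j≤j*[1+q] j)) (ℕ.≤-reflexive (sym n≡)))) n<p))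

  module _ (B : ℕ) where

    -- The coefficient of xⁿ in gᵖ, with zʲ replaced by `X j`.
    row : ℕ → ℕ → (ℕ → ℤ) → ℤ
    row n p X = ∑< B (λ j → coeff q n p j ℤ.* X j)

    row-cons : ∀ {n} p X → n < B →
               row n p X ≡ coeff q n p 0 ℤ.* X 0 ℤ.+ ∑< B (λ j → coeff q n p (suc j) ℤ.* X (suc j))
    row-cons {n} p X n<B = ∑<-cons B (λ j → coeff q n p j ℤ.* X j) (cong (ℤ._* X B) (coeff-big-j {p = p} n<B))

    shift-row : ∀ r n p X → shift r (λ n′ → row n′ p X) n ≡ ∑< B (λ j → shift r (λ n′ → coeff q n′ p j) n ℤ.* X j)
    shift-row r n p X = trans (shift-∑< r n B (λ n′ j → coeff q n′ p j ℤ.* X j))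
      (∑<-cong B (λ j _ → shift-*ʳ r n (λ n′ → coeff q n′ p j) (X j)))

    row-cong : ∀ n p {X Y} → (∀ j → X j ≡ Y j) → row n p X ≡ row n p Y
    row-cong n p X≗Y = ∑<-cong B (λ j _ → cong (coeff q n p j ℤ.*_) (X≗Y j))

    -- The identity (1 + u) gᵖ⁺¹ = (x + u) gᵖ, a factor z acting as `X ∘ suc`. The term j = 0 is
    -- split off because u raises j by one; the term j = B that appears in exchange is 0 since n <
    -- B.
    row-rec : ∀ {n} p X → n < B →
      row n (suc p) X ℤ.+ shift (suc q) (λ n′ → row n′ (suc p) (X ∘ suc)) n
      ≡ shift 1 (λ n′ → row n′ p X) n ℤ.+ shift (suc q) (λ n′ → row n′ p (X ∘ suc)) n
    row-rec {n} p X n<B = begin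
      row n (suc p) X ℤ.+ shift (suc q) (λ n′ → row n′ (suc p) (X ∘ suc)) n
        ≡⟨ cong₂ ℤ._+_ (row-cons (suc p) X n<B) (shift-row (suc q) n (suc p) (X ∘ suc)) ⟩
      u ℤ.* X 0 ℤ.+ ∑< B (λ j → f j ℤ.* X (suc j)) ℤ.+ ∑< B (λ j → g j ℤ.* X (suc j))
        ≡⟨ ℤ.+-assoc (u ℤ.* X 0) _ _ ⟩
      u ℤ.* X 0 ℤ.+ (∑< B (λ j → f j ℤ.* X (suc j)) ℤ.+ ∑< B (λ j → g j ℤ.* X (suc j)))
        ≡⟨ cong₂ (λ d e → d ℤ.* X 0 ℤ.+ e) (coeff-suc-0 n p) (collect f g) ⟩
      v ℤ.* X 0 ℤ.+ ∑< B (λ j → (f j ℤ.+ g j) ℤ.* X (suc j))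
        ≡⟨ cong (ℤ._+_ (v ℤ.* X 0)) (∑<-cong B (λ j _ → cong (ℤ._* X (suc j)) (coeff-suc-suc n p j))) ⟩
      v ℤ.* X 0 ℤ.+ ∑< B (λ j → (f′ j ℤ.+ g′ j) ℤ.* X (suc j))
        ≡⟨ cong (ℤ._+_ (v ℤ.* X 0)) (collect f′ g′) ⟨
      v ℤ.* X 0 ℤ.+ (∑< B (λ j → f′ j ℤ.* X (suc j)) ℤ.+ ∑< B (λ j → g′ j ℤ.* X (suc j)))
        ≡⟨ ℤ.+-assoc (v ℤ.* X 0) _ _ ⟨
      v ℤ.* X 0 ℤ.+ ∑< B (λ j → f′ j ℤ.* X (suc j)) ℤ.+ ∑< B (λ j → g′ j ℤ.* X (suc j))
        ≡⟨ cong (ℤ._+ ∑< B (λ j → g′ j ℤ.* X (suc j))) (∑<-cons B (λ j → shift 1 (λ n′ → coeff q n′ p j) n ℤ.* X j) last) ⟨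
      ∑< B (λ j → shift 1 (λ n′ → coeff q n′ p j) n ℤ.* X j) ℤ.+ ∑< B (λ j → g′ j ℤ.* X (suc j))
        ≡⟨ cong₂ ℤ._+_ (shift-row 1 n p X) (shift-row (suc q) n p (X ∘ suc)) ⟨
      shift 1 (λ n′ → row n′ p X) n ℤ.+ shift (suc q) (λ n′ → row n′ p (X ∘ suc)) n ∎
      where
      u v : ℤ
      u = coeff q n (suc p) 0
      v = shift 1 (λ n′ → coeff q n′ p 0) n
      f g f′ g′ : ℕ → ℤ
      f j = coeff q n (suc p) (suc j)
      g j = shift (suc q) (λ n′ → coeff q n′ (suc p) j) n
      f′ j = shift 1 (λ n′ → coeff q n′ p (suc j)) n
      g′ j = shift (suc q) (λ n′ → coeff q n′ p j) n
      collect : ∀ (f g : ℕ → ℤ) → ∑< B (λ j → f j ℤ.* X (suc j)) ℤ.+ ∑< B (λ j → g j ℤ.* X (suc j))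
                                ≡ ∑< B (λ j → (f j ℤ.+ g j) ℤ.* X (suc j))
      collect f g = trans (sym (∑<-+ B _ _)) (∑<-cong B (λ j _ → sym (ℤ.*-distribʳ-+ (X (suc j)) (f j) (g j))))
      last : shift 1 (λ n′ → coeff q n′ p B) n ℤ.* X B ≡ 0ℤ
      last = cong (ℤ._* X B) (shift-zero 1 n (λ x n≡ → coeff-big-j {p = p} (ℕ.<-trans (ℕ.≤-reflexive (sym n≡)) n<B)))

    -- `K⁺` is `K` after multiplication by one more factor g.
    K K⁺ : ℕ → (ℕ → ℕ → ℤ) → ℤ
    K  n X = ∑< B (λ p → row n p (X p))
    K⁺ n X = ∑< B (λ p → row n (suc p) (X p))

    K-rec : ∀ {n} X → n < B →
      K⁺ n X ℤ.+ shift (suc q) (λ n′ → K⁺ n′ (λ p → X p ∘ suc)) n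
      ≡ shift 1 (λ n′ → K n′ X) n ℤ.+ shift (suc q) (λ n′ → K n′ (λ p → X p ∘ suc)) n
    K-rec {n} X n<B = begin
      K⁺ n X ℤ.+ shift (suc q) (λ n′ → K⁺ n′ (λ p → X p ∘ suc)) n
        ≡⟨ cong (ℤ._+_ (K⁺ n X)) (shift-∑< (suc q) n B _) ⟩
      K⁺ n X ℤ.+ ∑< B (λ p → shift (suc q) (λ n′ → row n′ (suc p) (X p ∘ suc)) n)
        ≡⟨ ∑<-+ B _ _ ⟨
      ∑< B (λ p → row n (suc p) (X p) ℤ.+ shift (suc q) (λ n′ → row n′ (suc p) (X p ∘ suc)) n)
        ≡⟨ ∑<-cong B (λ p _ → row-rec p (X p) n<B) ⟩
      ∑< B (λ p → shift 1 (λ n′ → row n′ p (X p)) n ℤ.+ shift (suc q) (λ n′ → row n′ p (X p ∘ suc)) n)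
        ≡⟨ ∑<-+ B _ _ ⟩
      ∑< B (λ p → shift 1 (λ n′ → row n′ p (X p)) n) ℤ.+ ∑< B (λ p → shift (suc q) (λ n′ → row n′ p (X p ∘ suc)) n)
        ≡⟨ cong₂ ℤ._+_ (shift-∑< 1 n B (λ n′ p → row n′ p (X p))) (shift-∑< (suc q) n B _) ⟨
      shift 1 (λ n′ → K n′ X) n ℤ.+ shift (suc q) (λ n′ → K n′ (λ p → X p ∘ suc)) n ∎

    -- The coefficient of xⁿ in ∑ₚ Φ(p) ∏ᵢ gᵢ^pᵢ, with zʲ replaced by c j; all
    -- exponents run over [0, B), which is no restriction if B exceeds every n i.
    T : ∀ {k} → (Vector ℕ k → ℤ) → Vector ℕ k → (ℕ → ℤ) → ℤ
    T {zero}  Φ n c = Φ Vector.[] ℤ.* c 0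
    T {suc k} Φ n c = K (head n) (λ p j → T (λ t → Φ (p Vector.∷ t)) (tail n) (λ s → c (j + s)))

    T-cong : ∀ {k} {Φ Ψ : Vector ℕ k → ℤ} n {c d} → (∀ p → Φ p ≡ Ψ p) → (∀ s → c s ≡ d s) → T Φ n c ≡ T Ψ n d
    T-cong {zero}  n Φ≗Ψ c≗d = cong₂ ℤ._*_ (Φ≗Ψ Vector.[]) (c≗d 0)
    T-cong {suc k} n Φ≗Ψ c≗d = ∑<-cong B (λ p _ → row-cong (head n) p (λ j →
      T-cong (tail n) (λ t → Φ≗Ψ (p Vector.∷ t)) (λ s → c≗d (j + s))))

    row-0 : ∀ n p {X} → (∀ j → X j ≡ 0ℤ) → row n p X ≡ 0ℤ
    row-0 n p X≗0 = ∑<-zero B (λ j _ → trans (cong (coeff q n p j ℤ.*_) (X≗0 j)) (ℤ.*-zeroʳ (coeff q n p j)))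

    T-0 : ∀ {k} (n : Vector ℕ k) c → T (λ _ → 0ℤ) n c ≡ 0ℤ
    T-0 {zero}  n c = refl
    T-0 {suc k} n c = ∑<-zero B (λ p _ → row-0 (head n) p (λ j → T-0 (tail n) _))

    T-+ : ∀ {k} (Φ Ψ : Vector ℕ k → ℤ) n c → T (λ p → Φ p ℤ.+ Ψ p) n c ≡ T Φ n c ℤ.+ T Ψ n c
    T-+ {zero}  Φ Ψ n c = ℤ.*-distribʳ-+ (c 0) (Φ _) (Ψ _)
    T-+ {suc k} Φ Ψ n c = trans (∑<-cong B (λ p _ → trans
      (∑<-cong B (λ j _ → trans
        (cong (coeff q (head n) p j ℤ.*_) (T-+ _ _ (tail n) _))
        (ℤ.*-distribˡ-+ (coeff q (head n) p j) _ _)))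
      (∑<-+ B _ _))) (∑<-+ B _ _)

    T-∑ : ∀ {k l} (Φ : Fin l → Vector ℕ k → ℤ) n c →
          T (λ p → ∑ℤ (λ i → Φ i p)) n c ≡ ∑ℤ (λ i → T (Φ i) n c)
    T-∑ {l = zero}  Φ n c = T-0 n c
    T-∑ {l = suc l} Φ n c = trans (T-+ (Φ zero) _ n c) (cong (ℤ._+_ (T (Φ zero) n c)) (T-∑ (Φ ∘ suc) n c))

    -- Delaying `Φ` by one in its first argument raises the power of g by one. Reindexing the
    -- truncated sum brings in p = B, whose row vanishes because `head n < B`.
    T-δ-zero : ∀ {k} (Φ : Vector ℕ (suc k) → ℤ) n c → head n < B →
      T (δ zero 1 Φ) n c ≡ K⁺ (head n) (λ p j → T (λ t → Φ (p Vector.∷ t)) (tail n) (λ s → c (j + s)))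
    T-δ-zero Φ n c n₀<B = begin
      T (δ zero 1 Φ) n c      ≡⟨ ∑<-cons B (λ p → row (head n) p (X p)) last ⟩
      row (head n) 0 (X 0) ℤ.+ K⁺ (head n) (X ∘ suc)
        ≡⟨ cong (ℤ._+ K⁺ (head n) (X ∘ suc)) (row-0 (head n) 0 (λ j → T-0 (tail n) _)) ⟩
      0ℤ ℤ.+ K⁺ (head n) (X ∘ suc)  ≡⟨ ℤ.+-identityˡ _ ⟩
      K⁺ (head n) (X ∘ suc)   ∎
      where
      X : ℕ → ℕ → ℤ
      X p j = T (λ t → δ zero 1 Φ (p Vector.∷ t)) (tail n) (λ s → c (j + s))
      last : row (head n) B (X B) ≡ 0ℤ
      last = ∑<-zero B (λ j _ → cong (ℤ._* X B j) (coeff-big-p {p = B} {j = j} n₀<B))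

    -- (1 + z xᵢ^(q+1)) gᵢ = xᵢ + z xᵢ^(q+1).
    T-rec : ∀ {k} (i : Fin k) Φ n c → n i < B →
      T (δ i 1 Φ) n c ℤ.+ δ i (suc q) (λ n′ → T (δ i 1 Φ) n′ (c ∘ suc)) n
      ≡ δ i 1 (λ n′ → T Φ n′ c) n ℤ.+ δ i (suc q) (λ n′ → T Φ n′ (c ∘ suc)) n
    T-rec zero Φ n c n₀<B = begin
      T (δ zero 1 Φ) n c ℤ.+ shift (suc q) (λ x → T (δ zero 1 Φ) (x Vector.∷ tail n) (c ∘ suc)) (head n)
        ≡⟨ cong₂ ℤ._+_ (T-δ-zero Φ n c n₀<B)
             (shift-cong (suc q) (head n) (λ x x≤n → T-δ-zero Φ (x Vector.∷ tail n) (c ∘ suc) (ℕ.≤-<-trans x≤n n₀<B))) ⟩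
      K⁺ (head n) X ℤ.+ shift (suc q) (λ x → K⁺ x (λ p → X p ∘ suc)) (head n)
        ≡⟨ K-rec X n₀<B ⟩
      shift 1 (λ x → K x X) (head n) ℤ.+ shift (suc q) (λ x → K x (λ p → X p ∘ suc)) (head n) ∎
      where
      X : ℕ → ℕ → ℤ
      X p j = T (λ t → Φ (p Vector.∷ t)) (tail n) (λ s → c (j + s))
    T-rec (suc i) Φ n c nᵢ<B = begin
      T (δ (suc i) 1 Φ) n c ℤ.+ δ i (suc q) (λ t → T (δ (suc i) 1 Φ) (n₀ Vector.∷ t) (c ∘ suc)) (tail n)
        ≡⟨ cong (ℤ._+_ (T (δ (suc i) 1 Φ) n c)) (push (suc q) (δ (suc i) 1 Φ)) ⟩
      T (δ (suc i) 1 Φ) n c ℤ.+ ∑< B (λ p → ∑< B (λ j → coeff q n₀ p j ℤ.* δ i (suc q) (λ t → T (δ i 1 (Φ′ p)) t (c′ j ∘ suc)) (tail n)))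
        ≡⟨ join _ _ ⟩
      ∑< B (λ p → ∑< B (λ j → coeff q n₀ p j ℤ.* (T (δ i 1 (Φ′ p)) (tail n) (c′ j) ℤ.+ δ i (suc q) (λ t → T (δ i 1 (Φ′ p)) t (c′ j ∘ suc)) (tail n))))
        ≡⟨ ∑<-cong B (λ p _ → ∑<-cong B (λ j _ → cong (coeff q n₀ p j ℤ.*_) (T-rec i (Φ′ p) (tail n) (c′ j) nᵢ<B))) ⟩
      ∑< B (λ p → ∑< B (λ j → coeff q n₀ p j ℤ.* (δ i 1 (λ t → T (Φ′ p) t (c′ j)) (tail n) ℤ.+ δ i (suc q) (λ t → T (Φ′ p) t (c′ j ∘ suc)) (tail n))))
        ≡⟨ join _ _ ⟨
      ∑< B (λ p → ∑< B (λ j → coeff q n₀ p j ℤ.* δ i 1 (λ t → T (Φ′ p) t (c′ j)) (tail n))) ℤ.+ ∑< B (λ p → ∑< B (λ j → coeff q n₀ p j ℤ.* δ i (suc q) (λ t → T (Φ′ p) t (c′ j ∘ suc)) (tail n)))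
        ≡⟨ cong₂ ℤ._+_ (δ-K 1 (λ p j t → T (Φ′ p) t (c′ j))) (push (suc q) Φ) ⟨
      δ i 1 (λ t → T Φ (n₀ Vector.∷ t) c) (tail n) ℤ.+ δ i (suc q) (λ t → T Φ (n₀ Vector.∷ t) (c ∘ suc)) (tail n) ∎
      where
      n₀ : ℕ
      n₀ = head n
      Φ′ : ℕ → Vector ℕ _ → ℤ
      Φ′ p t = Φ (p Vector.∷ t)
      c′ : ℕ → ℕ → ℤ
      c′ j s = c (j + s)
      δ-K : ∀ r (Ψ : ℕ → ℕ → Vector ℕ _ → ℤ) →
            δ i r (λ t → K n₀ (λ p j → Ψ p j t)) (tail n)
            ≡ ∑< B (λ p → ∑< B (λ j → coeff q n₀ p j ℤ.* δ i r (Ψ p j) (tail n)))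
      δ-K r Ψ = trans (δ-∑< i r (tail n) B _) (∑<-cong B (λ p _ → δ-lin i r (tail n) B (coeff q n₀ p) (Ψ p)))
      push : ∀ r Ψ → δ i r (λ t → T Ψ (n₀ Vector.∷ t) (c ∘ suc)) (tail n)
             ≡ ∑< B (λ p → ∑< B (λ j → coeff q n₀ p j ℤ.* δ i r (λ t → T (λ t′ → Ψ (p Vector.∷ t′)) t (c′ j ∘ suc)) (tail n)))
      push r Ψ = trans (δ-K r _) (∑<-cong B (λ p _ → ∑<-cong B (λ j _ → cong (coeff q n₀ p j ℤ.*_)
        (δ-cong i r (tail n) (λ t → T-cong t (λ _ → refl) (λ s → cong c (sym (ℕ.+-suc j s))))))))
      join : ∀ (X Y : ℕ → ℕ → ℤ) →
             ∑< B (λ p → ∑< B (λ j → coeff q n₀ p j ℤ.* X p j)) ℤ.+ ∑< B (λ p → ∑< B (λ j → coeff q n₀ p j ℤ.* Y p j))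
             ≡ ∑< B (λ p → ∑< B (λ j → coeff q n₀ p j ℤ.* (X p j ℤ.+ Y p j)))
      join X Y = trans (sym (∑<-+ B _ _)) (∑<-cong B (λ p _ → trans (sym (∑<-+ B _ _))
        (∑<-cong B (λ j _ → sym (ℤ.*-distribˡ-+ (coeff q n₀ p j) (X p j) (Y p j))))))

∑-single : ∀ {k} (i : Fin k) (f : Vector ℤ k) → (∀ x → x ≢ i → f x ≡ 0ℤ) → ∑ℤ f ≡ f i
∑-single {suc k} i f f≗0 = begin
  ∑ℤ f                                  ≡⟨ sum-remove {i = i} f ⟩
  f i ℤ.+ ∑ℤ (Vector.removeAt f i)
    ≡⟨ cong (ℤ._+_ (f i)) (trans (sum-cong-≗ (λ j → f≗0 _ (Fin.punchInᵢ≢i i j))) (sum-replicate-zero k)) ⟩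
  f i ℤ.+ 0ℤ                            ≡⟨ ℤ.+-identityʳ _ ⟩
  f i                                   ∎

-- The leading run and the number of long runs

lead : ∀ {k} → Fin k → Word k → ℕ
lead i []      = 0
lead i (x ∷ w) with i Fin.≟ x
... | yes _ = suc (lead i w)
... | no  _ = 0

rest : ∀ {k} → Fin k → Word k → Word k
rest i []      = []
rest i (x ∷ w) with i Fin.≟ x
... | yes _ = rest i w
... | no  _ = x ∷ w

runs-∷ : ∀ {k} (x : Fin k) w → ∃₂ λ ys rs → runs (x ∷ w) ≡ (x ∷ ys) ∷ rs
         × length ys ≡ lead x w × map List⁺.length rs ≡ map List⁺.length (runs (rest x w))
runs-∷ x []      = [] , [] , refl , refl , refl
runs-∷ x (y ∷ w) with runs-∷ y w
... | ys , rs , eq , len , lens rewrite eq with x Fin.≟ y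
... | yes refl = y ∷ ys , rs , refl , cong suc len , lens
... | no _     = [] , (y ∷ ys) ∷ rs , refl , refl , cong (map List⁺.length) (sym eq)

long : ∀ {k} → ℕ → Word k → ℕ
long q w = length (filter (q ℕ.<?_) (map List⁺.length (runs w)))

exceeds : ℕ → ℕ → ℕ
exceeds q l = if does (q ℕ.<? l) then 1 else 0

long-∷ : ∀ {k} q (i : Fin k) w → long q (i ∷ w) ≡ exceeds q (suc (lead i w)) + long q (rest i w)
long-∷ q i w with runs-∷ i w
... | ys , rs , eq , len , lens rewrite eq | sym lens | sym len with does (q ℕ.<? suc (length ys))
... | true  = refl
... | false = refl

-- This needs no assumption on the first letter: if w does not start with i, its leading run of i is
-- empty, and length 0 exceeds no q.
long-rest : ∀ {k} q (i : Fin k) w → long q w ≡ exceeds q (lead i w) + long q (rest i w)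
long-rest q i []      = refl
long-rest q i (x ∷ w) with i Fin.≟ x
... | yes refl = long-∷ q i w
... | no  _    = refl

-- D t c s = ∑ⱼ (t C j) c (s + j), the action of (1 + z)ᵗ on c.
D : ℕ → (ℕ → ℤ) → ℕ → ℤ
D zero    c s = c s
D (suc t) c s = D t c s ℤ.+ D t c (suc s)

D-∘suc : ∀ t c s → D t (c ∘ suc) s ≡ D t c (suc s)
D-∘suc zero    c s = refl
D-∘suc (suc t) c s = cong₂ ℤ._+_ (D-∘suc t c s) (D-∘suc t c (suc s))

-- The contribution of z y^(number of long runs) from the words that
-- start with exactly r letters i, which are removed before counting.
ρ : ∀ {k} → ℕ → Fin k → ℕ → (ℕ → ℤ) → Word k → ℤ
ρ q i r c w = if does (lead i w ℕ.≟ r) then D (long q (rest i w)) (c ∘ suc) 0 else 0ℤ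

ρ-≡ : ∀ {k} q (i : Fin k) r c w → lead i w ≡ r → ρ q i r c w ≡ D (long q (rest i w)) (c ∘ suc) 0
ρ-≡ q i r c w eq = cong (λ b → if b then D (long q (rest i w)) (c ∘ suc) 0 else 0ℤ) (dec-true (lead i w ℕ.≟ r) eq)

ρ-≢ : ∀ {k} q (i : Fin k) r c w → lead i w ≢ r → ρ q i r c w ≡ 0ℤ
ρ-≢ q i r c w neq = cong (λ b → if b then D (long q (rest i w)) (c ∘ suc) 0 else 0ℤ) (dec-false (lead i w ℕ.≟ r) neq)

exceeds-< : ∀ {q l} → q < l → exceeds q l ≡ 1
exceeds-< {q} {l} q<l = cong (λ b → if b then 1 else 0) (dec-true (q ℕ.<? l) q<l)

exceeds-≤ : ∀ {q l} → l ≤ q → exceeds q l ≡ 0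
exceeds-≤ {q} {l} l≤q = cong (λ b → if b then 1 else 0) (dec-false (q ℕ.<? l) (ℕ.≤⇒≯ l≤q))

exceeds-suc : ∀ {q l} → l ≢ q → exceeds q (suc l) ≡ exceeds q l
exceeds-suc {q} {l} l≢q with q ℕ.<? l
... | yes q<l = trans (exceeds-< (ℕ.m<n⇒m<1+n q<l)) (sym (exceeds-< q<l))
... | no  q≮l = trans (exceeds-≤ (ℕ.≤∧≢⇒< (ℕ.≮⇒≥ q≮l) l≢q)) (sym (exceeds-≤ (ℕ.≮⇒≥ q≮l)))

-- Let t count the long runs behind the leading one. When the leading run grows from q to q + 1, yᵗ
-- becomes yᵗ⁺¹ = yᵗ + z yᵗ, and `ρ` is the added term. At every other length the leading run keeps
-- its status.
D-long-∷ : ∀ {k} q (i : Fin k) c w → D (long q (i ∷ w)) c 0 ≡ D (long q w) c 0 ℤ.+ ρ q i q c w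
D-long-∷ q i c w with lead i w ℕ.≟ q
... | yes l≡q = begin
  D (long q (i ∷ w)) c 0                   ≡⟨ cong (λ t → D t c 0) 1+rest ⟩
  D t c 0 ℤ.+ D t c 1                      ≡⟨ cong₂ ℤ._+_ (cong (λ t → D t c 0) (sym rest-only)) (sym (D-∘suc t c 0)) ⟩
  D (long q w) c 0 ℤ.+ D t (c ∘ suc) 0     ≡⟨ cong (ℤ._+_ (D (long q w) c 0)) (ρ-≡ q i q c w l≡q) ⟨
  D (long q w) c 0 ℤ.+ ρ q i q c w         ∎
  where
  t : ℕ
  t = long q (rest i w)
  1+rest : long q (i ∷ w) ≡ suc t
  1+rest = trans (long-∷ q i w) (cong (_+ t) (exceeds-< (s≤s (ℕ.≤-reflexive (sym l≡q)))))
  rest-only : long q w ≡ t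
  rest-only = trans (long-rest q i w) (cong (_+ t) (exceeds-≤ (ℕ.≤-reflexive l≡q)))
... | no l≢q = begin
  D (long q (i ∷ w)) c 0                   ≡⟨ cong (λ t → D t c 0) same ⟩
  D (long q w) c 0                         ≡⟨ ℤ.+-identityʳ _ ⟨
  D (long q w) c 0 ℤ.+ 0ℤ                  ≡⟨ cong (ℤ._+_ (D (long q w) c 0)) (ρ-≢ q i q c w l≢q) ⟨
  D (long q w) c 0 ℤ.+ ρ q i q c w         ∎
  where
  same : long q (i ∷ w) ≡ long q w
  same = trans (long-∷ q i w) (trans (cong (_+ long q (rest i w)) (exceeds-suc l≢q)) (sym (long-rest q i w)))

starts : ∀ {k} → Fin k → (Word k → ℤ) → Word k → ℤ
starts i φ []      = 0ℤ
starts i φ (x ∷ w) = if does (i Fin.≟ x) then φ (x ∷ w) else 0ℤ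

-- An empty leading run means that w does not start with i, and then `rest i w` is w itself; hence
-- the complement of `starts i`.
ρ-0 : ∀ {k} q (i : Fin k) c w → ρ q i 0 c w ≡ D (long q w) (c ∘ suc) 0 - starts i (λ v → D (long q v) (c ∘ suc) 0) w
ρ-0 q i c []      = sym (ℤ.+-identityʳ _)
ρ-0 q i c (x ∷ w) with i Fin.≟ x
... | yes _ = sym (ℤ.+-inverseʳ (D (long q (x ∷ w)) (c ∘ suc) 0))
... | no  _ = sym (ℤ.+-identityʳ _)

-- Weighted sums over the words of a given content

-- For ∑ℕ n ≡ N, the sum of φ w over all words w with content n.
W : ∀ {k} → ℕ → (Word k → ℤ) → Vector ℕ k → ℤ
W zero    φ n = φ []
W (suc N) φ n = ∑ℤ (λ i → δ i 1 (W N (λ w → φ (i ∷ w))) n)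

W-cong : ∀ {k} N {φ ψ : Word k → ℤ} n → (∀ w → φ w ≡ ψ w) → W N φ n ≡ W N ψ n
W-cong zero    n φ≗ψ = φ≗ψ []
W-cong (suc N) n φ≗ψ = sum-cong-≗ (λ i → δ-cong i 1 n (λ p → W-cong N p (λ w → φ≗ψ (i ∷ w))))

δ-+ : ∀ {k} (i : Fin k) r n Φ Ψ → δ i r (λ p → Φ p ℤ.+ Ψ p) n ≡ δ i r Φ n ℤ.+ δ i r Ψ n
δ-+ i r n Φ Ψ with δ-view i r n
... | inj₁ (_ , z)     rewrite z Φ | z Ψ = z _
... | inj₂ (_ , _ , s) rewrite s Φ | s Ψ = s _

δ-neg : ∀ {k} (i : Fin k) r n Φ → δ i r (λ p → ℤ.- Φ p) n ≡ ℤ.- δ i r Φ n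
δ-neg i r n Φ with δ-view i r n
... | inj₁ (_ , z)     rewrite z Φ = z _
... | inj₂ (_ , _ , s) rewrite s Φ = s _

δ-δ : ∀ {k} (i : Fin k) r s Φ n → δ i r (δ i s Φ) n ≡ δ i (r + s) Φ n
δ-δ zero    r s Φ n = shift-shift r s _ (head n)
δ-δ (suc i) r s Φ n = δ-δ i r s (λ t → Φ (head n Vector.∷ t)) (tail n)

δ-0 : ∀ {k} (i : Fin k) r n → δ i r (λ _ → 0ℤ) n ≡ 0ℤ
δ-0 i r n with δ-view i r n
... | inj₁ (_ , z)     = z _
... | inj₂ (_ , _ , s) = s _

δ-cong-reduct : ∀ {k} (i : Fin k) r n {Φ Ψ : Vector ℕ k → ℤ} →
                (∀ {p} → Reduct i r n p → Φ p ≡ Ψ p) → δ i r Φ n ≡ δ i r Ψ n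
δ-cong-reduct i r n {Φ} {Ψ} Φ≗Ψ with δ-view i r n
... | inj₁ (_ , z)        = trans (z Φ) (sym (z Ψ))
... | inj₂ (n′ , red , s) = trans (s Φ) (trans (Φ≗Ψ red) (sym (s Ψ)))

W-+ : ∀ {k} N (φ ψ : Word k → ℤ) n → W N (λ w → φ w ℤ.+ ψ w) n ≡ W N φ n ℤ.+ W N ψ n
W-+ zero    φ ψ n = refl
W-+ (suc N) φ ψ n = trans
  (sum-cong-≗ (λ i → trans (δ-cong i 1 n (λ p → W-+ N (λ w → φ (i ∷ w)) (λ w → ψ (i ∷ w)) p)) (δ-+ i 1 n _ _)))
  (∑-distrib-+ _ (λ i → δ i 1 (W N (λ w → ψ (i ∷ w))) n))

W-neg : ∀ {k} N (φ : Word k → ℤ) n → W N (λ w → ℤ.- φ w) n ≡ ℤ.- W N φ n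
W-neg zero    φ n = refl
W-neg (suc N) φ n = trans
  (sum-cong-≗ (λ i → trans (δ-cong i 1 n (λ p → W-neg N (λ w → φ (i ∷ w)) p)) (δ-neg i 1 n _)))
  (∑-neg (λ i → δ i 1 (W N (λ w → φ (i ∷ w))) n))
  where
  ∑-neg : ∀ {k} (f : Vector ℤ k) → ∑ℤ (λ i → ℤ.- f i) ≡ ℤ.- ∑ℤ f
  ∑-neg {zero}  f = refl
  ∑-neg {suc k} f = trans (cong (ℤ._+_ (ℤ.- f zero)) (∑-neg (tail f))) (sym (ℤ.neg-distrib-+ (f zero) _))

W-0 : ∀ {k} N {φ : Word k → ℤ} n → (∀ w → φ w ≡ 0ℤ) → W N φ n ≡ 0ℤ
W-0 zero    n φ≗0 = φ≗0 []
W-0 {k} (suc N) n φ≗0 = trans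
  (sum-cong-≗ (λ i → trans (δ-cong i 1 n (λ p → W-0 N p (λ w → φ≗0 (i ∷ w)))) (δ-0 i 1 n)))
  (sum-replicate-zero k)

W-single : ∀ {k} N (i : Fin k) (φ : Word k → ℤ) n → (∀ x w → x ≢ i → φ (x ∷ w) ≡ 0ℤ) →
           W (suc N) φ n ≡ δ i 1 (W N (λ w → φ (i ∷ w))) n
W-single N i φ n φ≗0 = ∑-single i (λ x → δ x 1 (W N (λ w → φ (x ∷ w))) n) (λ x x≢i → trans
  (δ-cong x 1 n (λ p → W-0 N p (λ w → φ≗0 x w x≢i))) (δ-0 x 1 n))

W-starts : ∀ {k} N (i : Fin k) φ n → W (suc N) (starts i φ) n ≡ δ i 1 (W N (λ w → φ (i ∷ w))) n
W-starts N i φ n = trans (W-single N i (starts i φ) n other) (δ-cong i 1 n (λ p → W-cong N p same))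
  where
  other : ∀ x w → x ≢ i → starts i φ (x ∷ w) ≡ 0ℤ
  other x w x≢i with i Fin.≟ x
  ... | yes i≡x = contradiction (sym i≡x) x≢i
  ... | no  _   = refl
  same : ∀ w → starts i φ (i ∷ w) ≡ φ (i ∷ w)
  same w with i Fin.≟ i
  ... | yes _   = refl
  ... | no  i≢i = contradiction refl i≢i

-- Only words starting with i contribute. Deleting that letter shortens the leading run by one and
-- leaves `rest` unchanged.
W-ρ-suc : ∀ {k} N q (i : Fin k) r c n → W (suc N) (ρ q i (suc r) c) n ≡ δ i 1 (W N (ρ q i r c)) n
W-ρ-suc N q i r c n = trans (W-single N i (ρ q i (suc r) c) n other) (δ-cong i 1 n (λ p → W-cong N p same))
  where
  other : ∀ x w → x ≢ i → ρ q i (suc r) c (x ∷ w) ≡ 0ℤ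
  other x w x≢i with i Fin.≟ x
  ... | yes i≡x = contradiction (sym i≡x) x≢i
  ... | no  _   = refl
  same : ∀ w → ρ q i (suc r) c (i ∷ w) ≡ ρ q i r c w
  same w with i Fin.≟ i
  ... | yes _   = refl
  ... | no  i≢i = contradiction refl i≢i

W-ρ-0 : ∀ {k} N q (i : Fin k) c n → W N (ρ q i 0 c) n
        ≡ W N (λ w → D (long q w) (c ∘ suc) 0) n - W N (starts i (λ w → D (long q w) (c ∘ suc) 0)) n
W-ρ-0 N q i c n = begin
  W N (ρ q i 0 c) n                         ≡⟨ W-cong N n (ρ-0 q i c) ⟩
  W N (λ w → φ w - starts i φ w) n          ≡⟨ W-+ N φ (λ w → ℤ.- starts i φ w) n ⟩
  W N φ n ℤ.+ W N (λ w → ℤ.- starts i φ w) n ≡⟨ cong (ℤ._+_ (W N φ n)) (W-neg N (starts i φ) n) ⟩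
  W N φ n - W N (starts i φ) n              ∎
  where
  φ : Word _ → ℤ
  φ w = D (long q w) (c ∘ suc) 0

-- Words against series: induction on the length

zeros : ∀ {k} → Vector ℕ k
zeros {zero}  = Vector.[]
zeros {suc k} = 0 Vector.∷ zeros

zeros-0 : ∀ {k} (i : Fin k) → zeros i ≡ 0
zeros-0 zero    = refl
zeros-0 (suc i) = zeros-0 i

∑ℕ-zeros : ∀ k → ∑ℕ (zeros {k}) ≡ 0
∑ℕ-zeros zero    = refl
∑ℕ-zeros (suc k) = ∑ℕ-zeros k

component≤∑ : ∀ {k} (n : Vector ℕ k) i → n i ≤ ∑ℕ n
component≤∑ n zero    = ℕ.m≤m+n (n zero) _
component≤∑ n (suc i) = ℕ.≤-trans (component≤∑ (tail n) i) (ℕ.m≤n+m _ (n zero))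

multinomial-zeros : ∀ k → multinomial (zeros {k}) ≡ 1
multinomial-zeros k = ℕ.m*n≡1⇒m≡1 _ (∏ℕ (λ i → zeros {k} i !))
  (trans (multinomial-∏! (zeros {k})) (cong _! (∑ℕ-zeros k)))

module _ (q : ℕ) where

  β-0-suc : ∀ x j {N} → x + j ≡ suc N → β x 0 j ≡ 0ℤ
  β-0-suc x j {N} eq = trans
    (cong (λ d → -1ℤ ^ (x + j + 0) ℤ.* + (κ d 0 * (0 C x))) eq)
    (ℤ.*-zeroʳ (-1ℤ ^ (x + j + 0)))

  coeff-suc-0-0 : ∀ n j → coeff q (suc n) 0 j ≡ 0ℤ
  coeff-suc-0-0 n zero    = β-0-suc (suc n) 0 (ℕ.+-identityʳ (suc n))
  coeff-suc-0-0 n (suc j) = shift-zero (suc j * suc q) (suc n) (λ x _ → β-0-suc x (suc j) (ℕ.+-suc x j))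

  -- At x⁰ only g⁰ = 1 survives.
  K-0 : ∀ B X → 0 < B → K q B 0 X ≡ X 0 0
  K-0 (suc B′) X _ = begin
    1ℤ ℤ.* X 0 0 ℤ.+ ∑< B′ (λ j → coeff q 0 0 (suc j) ℤ.* X 0 (suc j)) ℤ.+ ∑< B′ (λ p → row q (suc B′) 0 (suc p) (X (suc p)))
      ≡⟨ cong₂ (λ d e → 1ℤ ℤ.* X 0 0 ℤ.+ d ℤ.+ e)
           (∑<-zero B′ (λ j _ → cong (ℤ._* X 0 (suc j)) (coeff-big-j q {0} {0} {suc j} (s≤s z≤n))))
           (∑<-zero B′ (λ p _ → ∑<-zero (suc B′) (λ j _ → cong (ℤ._* X (suc p) j) (coeff-big-p q {0} {suc p} {j} (s≤s z≤n))))) ⟩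
    1ℤ ℤ.* X 0 0 ℤ.+ 0ℤ ℤ.+ 0ℤ
      ≡⟨ ℤ.+-identityʳ (1ℤ ℤ.* X 0 0 ℤ.+ 0ℤ) ⟩
    1ℤ ℤ.* X 0 0 ℤ.+ 0ℤ
      ≡⟨ ℤ.+-identityʳ (1ℤ ℤ.* X 0 0) ⟩
    1ℤ ℤ.* X 0 0
      ≡⟨ ℤ.*-identityˡ (X 0 0) ⟩
    X 0 0 ∎

module _ (q B : ℕ) where

  T-ext : ∀ {k} Φ {n m : Vector ℕ k} c → n ≗ m → T q B Φ n c ≡ T q B Φ m c
  T-ext {zero}  Φ c n≗m = refl
  T-ext {suc k} Φ {n} {m} c n≗m = trans
    (cong (λ x → K q B x (X n)) (n≗m zero))
    (∑<-cong B (λ p _ → row-cong q B (head m) p (λ j → T-ext _ _ (n≗m ∘ suc))))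
    where
    X : Vector ℕ (suc k) → ℕ → ℕ → ℤ
    X n p j = T q B (λ t → Φ (p Vector.∷ t)) (tail n) (λ s → c (j + s))

  T-zeros : ∀ {k} Φ (n : Vector ℕ k) c → 0 < B → ∑ℕ n ≡ 0 → T q B Φ n c ≡ Φ zeros ℤ.* c 0
  T-zeros {zero}  Φ n c 0<B ∑≡0 = refl
  T-zeros {suc k} Φ n c 0<B ∑≡0 = begin
    K q B (head n) X  ≡⟨ cong (λ x → K q B x X) (ℕ.m+n≡0⇒m≡0 (head n) ∑≡0) ⟩
    K q B 0 X         ≡⟨ K-0 q B X 0<B ⟩
    X 0 0             ≡⟨ T-zeros (λ t → Φ (0 Vector.∷ t)) (tail n) c 0<B (ℕ.m+n≡0⇒n≡0 (head n) ∑≡0) ⟩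
    Φ zeros ℤ.* c 0   ∎
    where
    X : ℕ → ℕ → ℤ
    X p j = T q B (λ t → Φ (p Vector.∷ t)) (tail n) (λ s → c (j + s))

  -- A `Φ` living at p = 0 alone produces a constant, which has no coefficient of positive degree.
  T-supported-at-0 : ∀ {k} Φ (n : Vector ℕ k) {S} c → 0 < B → (∀ p {S} → ∑ℕ p ≡ suc S → Φ p ≡ 0ℤ) →
                     ∑ℕ n ≡ suc S → T q B Φ n c ≡ 0ℤ
  T-supported-at-0 {suc k} Φ n {S} c 0<B Φ≗0 ∑≡ = helper (head n) refl
    where
    X : ℕ → ℕ → ℤ
    X p j = T q B (λ t → Φ (p Vector.∷ t)) (tail n) (λ s → c (j + s))
    helper : ∀ n₀ → head n ≡ n₀ → T q B Φ n c ≡ 0ℤ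
    helper zero n₀≡ = begin
      K q B (head n) X  ≡⟨ cong (λ x → K q B x X) n₀≡ ⟩
      K q B 0 X         ≡⟨ K-0 q B X 0<B ⟩
      X 0 0             ≡⟨ T-supported-at-0 (λ t → Φ (0 Vector.∷ t)) (tail n) c 0<B
                             (λ t → Φ≗0 (0 Vector.∷ t)) (trans (cong (_+ ∑ℕ (tail n)) (sym n₀≡)) ∑≡) ⟩
      0ℤ                ∎
    helper (suc n₀) n₀≡ = begin
      K q B (head n) X  ≡⟨ cong (λ x → K q B x X) n₀≡ ⟩
      K q B (suc n₀) X  ≡⟨ ∑<-zero B (λ { zero _ → ∑<-zero B (λ j _ → cong (ℤ._* X 0 j) (coeff-suc-0-0 q n₀ j))
                                        ; (suc p) _ → row-0 q B (suc n₀) (suc p) (λ j → X-suc p j) }) ⟩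
      0ℤ                ∎
      where
      X-suc : ∀ p j → X (suc p) j ≡ 0ℤ
      X-suc p j = trans (T-cong q B (tail n) {d = λ s → c (j + s)} (λ t → Φ≗0 (suc p Vector.∷ t) refl) (λ _ → refl))
                        (T-0 q B (tail n) _)

  -- The multinomial recurrence fails only at p = 0, where the left side is 1 and the right side 0.
  -- This defect is the summand 1 in V = 1 + ∑ᵢ Vᵢ and is invisible in positive degree.
  T-multinomial : ∀ {k} (n : Vector ℕ k) {S} c → 0 < B → ∑ℕ n ≡ suc S →
                  T q B multinomialℤ n c ≡ ∑ℤ (λ i → T q B (δ i 1 multinomialℤ) n c)
  T-multinomial n c 0<B ∑≡ = begin
    T q B multinomialℤ n c
      ≡⟨ T-cong q B n (λ p → sym (split (multinomialℤ p) (ΣM p))) (λ _ → refl) ⟩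
    T q B (λ p → ΣM p ℤ.+ (multinomialℤ p - ΣM p)) n c
      ≡⟨ T-+ q B ΣM (λ p → multinomialℤ p - ΣM p) n c ⟩
    T q B ΣM n c ℤ.+ T q B (λ p → multinomialℤ p - ΣM p) n c
      ≡⟨ cong₂ ℤ._+_ (T-∑ q B (λ i → δ i 1 multinomialℤ) n c) (T-supported-at-0 (λ p → multinomialℤ p - ΣM p) n c 0<B
           (λ p ∑p≡ → ℤ.i≡j⇒i-j≡0 (multinomial-rec p ∑p≡)) ∑≡) ⟩
    ∑ℤ (λ i → T q B (δ i 1 multinomialℤ) n c) ℤ.+ 0ℤ
      ≡⟨ ℤ.+-identityʳ _ ⟩
    ∑ℤ (λ i → T q B (δ i 1 multinomialℤ) n c) ∎
    where
    ΣM : Vector ℕ _ → ℤ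
    ΣM p = ∑ℤ (λ i → δ i 1 multinomialℤ p)
    split : ∀ x y → y ℤ.+ (x - y) ≡ x
    split = solve-∀

  -- Each Vᵢ depends on both V and Vᵢ at smaller content, so the two parts are carried together. All
  -- `c` are covered at once because a factor z turns `c` into `c ∘ suc`.
  Claim : ∀ {k} → ℕ → Vector ℕ k → Set
  Claim N n = ∀ c → W N (λ w → D (long q w) c 0) n ≡ T q B multinomialℤ n c
                  × (∀ i → W N (starts i (λ w → D (long q w) c 0)) n ≡ T q B (δ i 1 multinomialℤ) n c)

  module _ {k} (N : ℕ) (ih : ∀ {N′} → N′ < N → (n : Vector ℕ k) → ∑ℕ n ≡ N′ → Claim N′ n) where

    -- The series for z (V - Vᵢ), to be matched with the words that do not start with i.
    G : Fin k → (ℕ → ℤ) → Vector ℕ k → ℤ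
    G i c n = T q B multinomialℤ n (c ∘ suc) - T q B (δ i 1 multinomialℤ) n (c ∘ suc)

    -- A word whose leading run of i has length r is iʳ followed by a word not starting with i.
    -- Peeling off the r letters ends at `G`, evaluated by the induction hypothesis.
    W-ρ : ∀ N′ r i c n → N′ < N → ∑ℕ n ≡ N′ → W N′ (ρ q i r c) n ≡ δ i r (G i c) n
    W-ρ N′ zero i c n N′<N ∑≡ with δ-view i 0 n
    -- Even for r = 0 the operator `δ` rebuilds its vector, so `n′` is only pointwise equal to `n`.
    ... | inj₂ (n′ , red , s) = begin
      W N′ (ρ q i 0 c) n      ≡⟨ W-ρ-0 N′ q i c n ⟩
      W N′ (λ w → D (long q w) (c ∘ suc) 0) n - W N′ (starts i (λ w → D (long q w) (c ∘ suc) 0)) n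
        ≡⟨ cong₂ _-_ (proj₁ (ih N′<N n ∑≡ (c ∘ suc))) (proj₂ (ih N′<N n ∑≡ (c ∘ suc)) i) ⟩
      G i c n                 ≡⟨ cong₂ _-_ (T-ext multinomialℤ (c ∘ suc) n≗n′) (T-ext (δ i 1 multinomialℤ) (c ∘ suc) n≗n′) ⟩
      G i c n′                ≡⟨ s (G i c) ⟨
      δ i 0 (G i c) n         ∎
      where
      n≗n′ : n ≗ n′
      n≗n′ j with j Fin.≟ i
      ... | yes refl = Reduct.here red
      ... | no j≢i   = Reduct.there red j j≢i
    W-ρ zero (suc r) i c n N′<N ∑≡ with δ-view i (suc r) n
    ... | inj₁ (_ , z)       = sym (z (G i c))
    ... | inj₂ (_ , red , _) = contradiction (trans (sym ∑≡) (reduct-∑ red)) λ()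
    W-ρ (suc N′) (suc r) i c n N′<N ∑≡ = begin
      W (suc N′) (ρ q i (suc r) c) n   ≡⟨ W-ρ-suc N′ q i r c n ⟩
      δ i 1 (W N′ (ρ q i r c)) n
        ≡⟨ δ-cong-reduct i 1 n (λ {p} red → W-ρ N′ r i c p (ℕ.<-trans (ℕ.n<1+n N′) N′<N)
             (ℕ.suc-injective (trans (sym (reduct-∑ red)) ∑≡))) ⟩
      δ i 1 (δ i r (G i c)) n          ≡⟨ δ-δ i 1 r (G i c) n ⟩
      δ i (suc r) (G i c) n            ∎

  -- For words, Vᵢ = xᵢ (V + z xᵢ^q (V - Vᵢ)), where the bracket concerns shorter words only.
  -- Substituting the series there and solving `T-rec` for its first term gives the series for Vᵢ.
  starts-step : ∀ {k} N (ih : ∀ {N′} → N′ < suc N → (n : Vector ℕ k) → ∑ℕ n ≡ N′ → Claim N′ n) →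
                suc N < B → ∀ n → ∑ℕ n ≡ suc N → ∀ c i →
                δ i 1 (W N (λ w → D (long q (i ∷ w)) c 0)) n ≡ T q B (δ i 1 multinomialℤ) n c
  starts-step N ih N<B n ∑≡ c i = begin
    δ i 1 (W N (λ w → D (long q (i ∷ w)) c 0)) n
      ≡⟨ δ-cong-reduct i 1 n (λ {p} red → step p (ℕ.suc-injective (trans (sym (reduct-∑ red)) ∑≡))) ⟩
    δ i 1 (λ p → T q B multinomialℤ p c ℤ.+ δ i q G′ p) n
      ≡⟨ δ-+ i 1 n (λ p → T q B multinomialℤ p c) (δ i q G′) ⟩
    A ℤ.+ δ i 1 (δ i q G′) n
      ≡⟨ cong (ℤ._+_ A) (δ-δ i 1 q G′ n) ⟩
    A ℤ.+ δ i (suc q) G′ n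
      ≡⟨ cong (ℤ._+_ A) (trans (δ-+ i (suc q) n (λ p → T q B multinomialℤ p (c ∘ suc)) _)
           (cong (ℤ._+_ A′) (δ-neg i (suc q) n (λ p → T q B (δ i 1 multinomialℤ) p (c ∘ suc))))) ⟩
    A ℤ.+ (A′ - S′)
      ≡⟨ ℤ.+-assoc A A′ (ℤ.- S′) ⟨
    A ℤ.+ A′ - S′
      ≡⟨ cong (_- S′) (T-rec q B i multinomialℤ n c (ℕ.≤-<-trans (component≤∑ n i) (subst (_< B) (sym ∑≡) N<B))) ⟨
    S ℤ.+ S′ - S′
      ≡⟨ cancel S S′ ⟩
    S ∎
    where
    G′ : Vector ℕ _ → ℤ
    G′ = G (suc N) ih i c
    A A′ S S′ : ℤ
    A  = δ i 1 (λ p → T q B multinomialℤ p c) n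
    A′ = δ i (suc q) (λ p → T q B multinomialℤ p (c ∘ suc)) n
    S  = T q B (δ i 1 multinomialℤ) n c
    S′ = δ i (suc q) (λ p → T q B (δ i 1 multinomialℤ) p (c ∘ suc)) n
    cancel : ∀ x y → x ℤ.+ y - y ≡ x
    cancel = solve-∀
    step : ∀ p → ∑ℕ p ≡ N → W N (λ w → D (long q (i ∷ w)) c 0) p ≡ T q B multinomialℤ p c ℤ.+ δ i q G′ p
    step p ∑p≡ = begin
      W N (λ w → D (long q (i ∷ w)) c 0) p
        ≡⟨ W-cong N p (D-long-∷ q i c) ⟩
      W N (λ w → D (long q w) c 0 ℤ.+ ρ q i q c w) p
        ≡⟨ W-+ N _ (ρ q i q c) p ⟩
      W N (λ w → D (long q w) c 0) p ℤ.+ W N (ρ q i q c) p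
        ≡⟨ cong₂ ℤ._+_ (proj₁ (ih (ℕ.n<1+n N) p ∑p≡ c)) (W-ρ (suc N) ih N q i c p (ℕ.n<1+n N) ∑p≡) ⟩
      T q B multinomialℤ p c ℤ.+ δ i q G′ p ∎

  claim : ∀ {k} N → N < B → (n : Vector ℕ k) → ∑ℕ n ≡ N → Claim N n
  -- Strong induction is called for because a step removes up to q + 1 letters.
  claim {k} = <-rec (λ N → N < B → (n : Vector ℕ k) → ∑ℕ n ≡ N → Claim N n) step
    where
    step : ∀ N → (∀ {N′} → N′ < N → N′ < B → (n : Vector ℕ k) → ∑ℕ n ≡ N′ → Claim N′ n) →
           N < B → (n : Vector ℕ k) → ∑ℕ n ≡ N → Claim N n
    step zero _ 0<B n ∑≡ c = sym empty , λ i → sym (none i)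
      where
      empty : T q B multinomialℤ n c ≡ c 0
      empty = trans (T-zeros multinomialℤ n c 0<B ∑≡) (trans (cong (λ d → + d ℤ.* c 0) (multinomial-zeros k)) (ℤ.*-identityˡ (c 0)))
      none : ∀ i → T q B (δ i 1 multinomialℤ) n c ≡ 0ℤ
      none i = trans (T-zeros (δ i 1 multinomialℤ) n c 0<B ∑≡) (cong (ℤ._* c 0) δM≡0)
        where
        δM≡0 : δ i 1 multinomialℤ zeros ≡ 0ℤ
        δM≡0 with δ-view i 1 (zeros {k})
        ... | inj₁ (_ , z)       = z multinomialℤ
        ... | inj₂ (_ , red , _) = contradiction (trans (sym (zeros-0 i)) (Reduct.here red)) λ()
    step (suc N) ih N<B n ∑≡ c = total , λ i → trans (W-starts N i (λ w → D (long q w) c 0) n) (starts-n i)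
      where
      starts-n : ∀ i → δ i 1 (W N (λ w → D (long q (i ∷ w)) c 0)) n ≡ T q B (δ i 1 multinomialℤ) n c
      starts-n = starts-step N (λ N′<1+N → ih N′<1+N (ℕ.<-trans N′<1+N N<B)) N<B n ∑≡ c
      total : W (suc N) (λ w → D (long q w) c 0) n ≡ T q B multinomialℤ n c
      total = trans (sum-cong-≗ starts-n) (sym (T-multinomial n c (ℕ.≤-<-trans z≤n N<B) ∑≡))

-- From sorted run lengths to the number of long runs

indicator : ∀ {A : Set} → Dec A → ℤ
indicator A? = if does A? then 1ℤ else 0ℤ

indicator-true : ∀ {A : Set} (A? : Dec A) → A → indicator A? ≡ 1ℤ
indicator-true A? x = cong (λ b → if b then 1ℤ else 0ℤ) (dec-true A? x)

indicator-false : ∀ {A : Set} (A? : Dec A) → ¬ A → indicator A? ≡ 0ℤ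
indicator-false A? ¬x = cong (λ b → if b then 1ℤ else 0ℤ) (dec-false A? ¬x)

indicator-⇔ : ∀ {A B : Set} (A? : Dec A) (B? : Dec B) → A ⇔ B → indicator A? ≡ indicator B?
indicator-⇔ A? B? A⇔B = cong (λ b → if b then 1ℤ else 0ℤ) (does-⇔ A⇔B A? B?)

-- In a decreasing list the entries above q form a prefix, and the entry at position m lies outside
-- it exactly when the prefix has length at most m. The default 0 past the end agrees with this, as
-- 0 ≤ q.
filter-length-sorted : ∀ q m {xs} → AllPairs (flip _≤_) xs →
  fromMaybe 0 (List.head (drop m xs)) ≤ q ⇔ length (filter (q ℕ.<?_) xs) ≤ m
filter-length-sorted q zero    []          = mk⇔ (λ _ → z≤n) (λ _ → z≤n)
filter-length-sorted q (suc m) []          = mk⇔ (λ _ → z≤n) (λ _ → z≤n)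
filter-length-sorted q m {x ∷ xs} (xs≤x ∷ sorted) with x ℕ.≤? q
... | yes x≤q = subst (λ l → fromMaybe 0 (List.head (drop m (x ∷ xs))) ≤ q ⇔ l ≤ m) (sym none) (mk⇔ (λ _ → z≤n) (λ _ → small m all≤q))
  where
  all≤q : All (_≤ q) (x ∷ xs)
  all≤q = x≤q ∷ All.map (λ y≤x → ℕ.≤-trans y≤x x≤q) xs≤x
  none : length (filter (q ℕ.<?_) (x ∷ xs)) ≡ 0
  none = cong length (List.filter-none (q ℕ.<?_) (All.map ℕ.≤⇒≯ all≤q))
  small : ∀ m {xs} → All (_≤ q) xs → fromMaybe 0 (List.head (drop m xs)) ≤ q
  small zero    []         = z≤n
  small zero    (y≤q ∷ _)  = y≤q
  small (suc m) []         = z≤n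
  small (suc m) (_ ∷ ys≤q) = small m ys≤q
... | no x≰q = subst (λ l → fromMaybe 0 (List.head (drop m (x ∷ xs))) ≤ q ⇔ l ≤ m) (sym (cong length (List.filter-accept (q ℕ.<?_) (ℕ.≰⇒> x≰q)))) (cut m)
  where
  cut : ∀ m → fromMaybe 0 (List.head (drop m (x ∷ xs))) ≤ q ⇔ suc (length (filter (q ℕ.<?_) xs)) ≤ m
  cut zero    = mk⇔ (λ x≤q → contradiction x≤q x≰q) (λ ())
  cut (suc m) = mk⇔ (s≤s ∘ Equivalence.to (filter-length-sorted q m sorted))
                    (Equivalence.from (filter-length-sorted q m sorted) ∘ s≤s⁻¹)

ℓ≤⇔long≤ : ∀ {k} q m (w : Word k) → ℓ m w ≤ q ⇔ long q w ≤ m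
ℓ≤⇔long≤ q m w = subst (λ l → ℓ m w ≤ q ⇔ l ≤ m)
  (↭-length (filter-↭ (q ℕ.<?_) (sortDecreasing-↭ lengths)))
  (filter-length-sorted q m (Linked⇒AllPairs (flip ℕ.≤-trans) (sortDecreasing-↗ lengths)))
  where
  lengths : List ℕ
  lengths = map List⁺.length (runs w)

length-runs-≤ : ∀ {k} (w : Word k) → length (runs w) ≤ length w
length-runs-≤ []      = z≤n
length-runs-≤ (x ∷ w) = ℕ.≤-trans (consRun-≤ (runs w)) (s≤s (length-runs-≤ w))
  where
  consRun-≤ : ∀ rs → length (consRun x rs) ≤ suc (length rs)
  consRun-≤ []               = s≤s z≤n
  consRun-≤ ((y ∷ ys) ∷ rs) with x Fin.≟ y
  ... | yes _ = ℕ.n≤1+n _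
  ... | no  _ = ℕ.≤-refl

long≤length : ∀ {k} q (w : Word k) → long q w ≤ length w
long≤length q w = ℕ.≤-trans (List.length-filter (q ℕ.<?_) (map List⁺.length (runs w)))
  (ℕ.≤-trans (ℕ.≤-reflexive (List.length-map List⁺.length (runs w))) (length-runs-≤ w))

-- The functional that detects t ≤ m

-- The coefficients with ∑ⱼ (t C j) threshold m j = 1 for t ≤ m and 0 for t > m.
threshold : ℕ → ℕ → ℤ
threshold m zero    = 1ℤ
threshold m (suc j) = -1ℤ ^ (suc j + m) ℤ.* + (j C m)

threshold-0 : ∀ s → threshold 0 s ℤ.+ threshold 0 (suc s) ≡ 0ℤ
threshold-0 zero    = refl
threshold-0 (suc s) rewrite C-0 s | C-0 (suc s) = cancel (-1ℤ ^ (s + 0))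
  where
  cancel : ∀ x → -1ℤ ℤ.* x ℤ.* 1ℤ ℤ.+ -1ℤ ℤ.* (-1ℤ ℤ.* x) ℤ.* 1ℤ ≡ 0ℤ
  cancel = solve-∀

-- Multiplication by y = 1 + z lowers the threshold by one, in accordance with t + 1 ≤ m + 1 being t
-- ≤ m; the computation is Pascal's rule with alternating signs.
threshold-suc : ∀ m s → threshold (suc m) s ℤ.+ threshold (suc m) (suc s) ≡ threshold m s
threshold-suc m zero rewrite k>n⇒nCk≡0 {0} {suc m} (s≤s z≤n) = cong (ℤ._+_ 1ℤ) (ℤ.*-zeroʳ (-1ℤ ^ (1 + suc m)))
threshold-suc m (suc s) rewrite ℕ.+-suc s m | C-suc s m = trans
  (cong (λ d → -1ℤ ℤ.* (-1ℤ ℤ.* x) ℤ.* + (s C suc m) ℤ.+ -1ℤ ℤ.* (-1ℤ ℤ.* (-1ℤ ℤ.* x)) ℤ.* d) (ℤ.pos-+ (s C m) (s C suc m)))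
  (cancel x (+ (s C m)) (+ (s C suc m)))
  where
  x = -1ℤ ^ (s + m)
  cancel : ∀ x u v → -1ℤ ℤ.* (-1ℤ ℤ.* x) ℤ.* v ℤ.+ -1ℤ ℤ.* (-1ℤ ℤ.* (-1ℤ ℤ.* x)) ℤ.* (u ℤ.+ v) ≡ -1ℤ ℤ.* x ℤ.* u
  cancel = solve-∀

D-threshold-≤ : ∀ t {m} s → t ≤ m → D t (threshold m) s ≡ threshold (m ∸ t) s
D-threshold-≤ zero    s t≤m = refl
D-threshold-≤ (suc t) {suc m} s (s≤s t≤m) = begin
  D t (threshold (suc m)) s ℤ.+ D t (threshold (suc m)) (suc s)
    ≡⟨ cong₂ ℤ._+_ (D-threshold-≤ t s (ℕ.m≤n⇒m≤1+n t≤m)) (D-threshold-≤ t (suc s) (ℕ.m≤n⇒m≤1+n t≤m)) ⟩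
  threshold (suc m ∸ t) s ℤ.+ threshold (suc m ∸ t) (suc s)
    ≡⟨ cong (λ d → threshold d s ℤ.+ threshold d (suc s)) (ℕ.+-∸-assoc 1 t≤m) ⟩
  threshold (suc (m ∸ t)) s ℤ.+ threshold (suc (m ∸ t)) (suc s)
    ≡⟨ threshold-suc (m ∸ t) s ⟩
  threshold (m ∸ t) s ∎

-- After m factors y the threshold is 0, where the values are (-1)^s. The next factor annihilates
-- this alternating sequence, and it stays 0.
D-threshold-> : ∀ t {m} s → m < t → D t (threshold m) s ≡ 0ℤ
D-threshold-> (suc t) {m} s (s≤s m≤t) with m ℕ.≟ t
... | yes refl = begin
  D m (threshold m) s ℤ.+ D m (threshold m) (suc s)
    ≡⟨ cong₂ ℤ._+_ (D-threshold-≤ m s ℕ.≤-refl) (D-threshold-≤ m (suc s) ℕ.≤-refl) ⟩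
  threshold (m ∸ m) s ℤ.+ threshold (m ∸ m) (suc s)
    ≡⟨ cong (λ d → threshold d s ℤ.+ threshold d (suc s)) (ℕ.n∸n≡0 m) ⟩
  threshold 0 s ℤ.+ threshold 0 (suc s)
    ≡⟨ threshold-0 s ⟩
  0ℤ ∎
... | no m≢t = cong₂ ℤ._+_ (D-threshold-> t s (ℕ.≤∧≢⇒< m≤t m≢t)) (D-threshold-> t (suc s) (ℕ.≤∧≢⇒< m≤t m≢t))

D-threshold : ∀ t m → D t (threshold m) 0 ≡ indicator (t ℕ.≤? m)
D-threshold t m with t ℕ.≤? m
... | yes t≤m = trans (D-threshold-≤ t 0 t≤m) (sym (indicator-true (t ℕ.≤? m) t≤m))
... | no  t≰m = trans (D-threshold-> t 0 (ℕ.≰⇒> t≰m)) (sym (indicator-false (t ℕ.≤? m) t≰m))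

-- Counting the enumerated words

length-filter-map : ∀ {A B : Set} {P : Pred B 0ℓ} (P? : Decidable P) (f : A → B) xs →
                    length (filter P? (map f xs)) ≡ length (filter (P? ∘ f) xs)
length-filter-map P? f []       = refl
length-filter-map P? f (x ∷ xs) with does (P? (f x))
... | true  = cong suc (length-filter-map P? f xs)
... | false = length-filter-map P? f xs

length-filter-product : ∀ {A B E : Set} {P : Pred E 0ℓ} (P? : Decidable P) (f : A → B → E) {l} (g : Fin l → A) ys →
  + length (filter P? (cartesianProductWith f (tabulate g) ys)) ≡ ∑ℤ (λ i → + length (filter (λ y → P? (f (g i) y)) ys))
length-filter-product P? f {zero}  g ys = refl
length-filter-product P? f {suc l} g ys = begin
  + length (filter P? (map (f (g zero)) ys ++ others))
    ≡⟨ cong (λ zs → + length zs) (List.filter-++ P? (map (f (g zero)) ys) others) ⟩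
  + length (filter P? (map (f (g zero)) ys) ++ filter P? others)
    ≡⟨ cong +_ (List.length-++ (filter P? (map (f (g zero)) ys))) ⟩
  + length (filter P? (map (f (g zero)) ys)) ℤ.+ + length (filter P? others)
    ≡⟨ cong₂ ℤ._+_ (cong +_ (length-filter-map P? (f (g zero)) ys)) (length-filter-product P? f (g ∘ suc) ys) ⟩
  ∑ℤ (λ i → + length (filter (λ y → P? (f (g i) y)) ys)) ∎
  where
  others : List _
  others = cartesianProductWith f (tabulate (g ∘ suc)) ys

content-∷ : ∀ {k} {i : Fin k} {n n′ : Vector ℕ k} → Reduct i 1 n n′ → ∀ w → HasContent n (i ∷ w) ⇔ HasContent n′ w
content-∷ {i = i} {n} {n′} red w = mk⇔ to from
  where
  open Reduct red
  count-here : count i (i ∷ w) ≡ suc (count i w)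
  count-here = cong length (List.filter-accept (i Fin.≟_) refl)
  count-there : ∀ {j} → j ≢ i → count j (i ∷ w) ≡ count j w
  count-there {j} j≢i = cong length (List.filter-reject (j Fin.≟_) j≢i)
  to : HasContent n (i ∷ w) → HasContent n′ w
  to h j = at (j Fin.≟ i)
    where
    at : Dec (j ≡ i) → count j w ≡ n′ j
    at (yes refl) = ℕ.suc-injective (trans (sym count-here) (trans (h i) here))
    at (no j≢i)   = trans (sym (count-there j≢i)) (trans (h j) (there j j≢i))
  from : HasContent n′ w → HasContent n (i ∷ w)
  from h j = at (j Fin.≟ i)
    where
    at : Dec (j ≡ i) → count j (i ∷ w) ≡ n j
    at (yes refl) = trans count-here (trans (cong suc (h i)) (sym here))
    at (no j≢i)   = trans (count-there j≢i) (trans (h j) (sym (there j j≢i)))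

no-content-∷ : ∀ {k} {i : Fin k} {n : Vector ℕ k} → n i < 1 → ∀ w → ¬ HasContent n (i ∷ w)
no-content-∷ {i = i} {n} nᵢ<1 w h = contradiction nᵢ<1 (ℕ.≤⇒≯ (ℕ.≤-trans (s≤s z≤n)
  (ℕ.≤-reflexive (trans (sym (cong length (List.filter-accept (i Fin.≟_) refl))) (h i)))))

-- The enumeration and `W` branch on the same first letter. A letter absent from the content admits
-- no word, and there `δ` is 0.
length-filter-content : ∀ {k} N {R : Pred (Word k) 0ℓ} (R? : Decidable R) n → ∑ℕ n ≡ N →
  + length (filter (λ w → hasContent? n w ×-dec R? w) (wordsOfLength k N)) ≡ W N (λ w → indicator (R? w)) n
length-filter-content {k} zero R? n ∑≡ = at (R? [])
  where
  P? : Decidable (λ w → HasContent n w × _)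
  P? w = hasContent? n w ×-dec R? w
  empty : HasContent n []
  empty i = sym (ℕ.n≤0⇒n≡0 (ℕ.≤-trans (component≤∑ n i) (ℕ.≤-reflexive ∑≡)))
  at : Dec _ → + length (filter P? ([] ∷ [])) ≡ indicator (R? [])
  at (yes r) = trans (cong (λ ws → + length ws) (List.filter-accept P? (empty , r))) (sym (indicator-true (R? []) r))
  at (no ¬r) = trans (cong (λ ws → + length ws) (List.filter-reject P? (¬r ∘ proj₂))) (sym (indicator-false (R? []) ¬r))
length-filter-content {k} (suc N) {R} R? n ∑≡ = trans
  (length-filter-product (λ w → hasContent? n w ×-dec R? w) _∷_ (λ i → i) (wordsOfLength k N))
  (sum-cong-≗ term)
  where
  term : ∀ i → + length (filter (λ w → hasContent? n (i ∷ w) ×-dec R? (i ∷ w)) (wordsOfLength k N))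
             ≡ δ i 1 (W N (λ w → indicator (R? (i ∷ w)))) n
  term i with δ-view i 1 n
  ... | inj₁ (nᵢ<1 , z) = trans
    (cong (λ ws → + length ws) (List.filter-none (λ w → hasContent? n (i ∷ w) ×-dec R? (i ∷ w))
      (All.universal (λ w (h , _) → no-content-∷ {n = n} nᵢ<1 w h) (wordsOfLength k N))))
    (sym (z _))
  ... | inj₂ (n′ , red , s) = begin
    + length (filter (λ w → hasContent? n (i ∷ w) ×-dec R? (i ∷ w)) (wordsOfLength k N))
      ≡⟨ cong (λ ws → + length ws) (List.filter-≐ (λ w → hasContent? n (i ∷ w) ×-dec R? (i ∷ w))
           (λ w → hasContent? n′ w ×-dec R? (i ∷ w))
           ( (λ {w} (h , r) → Equivalence.to (content-∷ red w) h , r)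
           , (λ {w} (h , r) → Equivalence.from (content-∷ red w) h , r)) (wordsOfLength k N)) ⟩
    + length (filter (λ w → hasContent? n′ w ×-dec R? (i ∷ w)) (wordsOfLength k N))
      ≡⟨ length-filter-content N (λ w → R? (i ∷ w)) n′ (ℕ.suc-injective (trans (sym (reduct-∑ red)) ∑≡)) ⟩
    W N (λ w → indicator (R? (i ∷ w))) n′
      ≡⟨ s _ ⟨
    δ i 1 (W N (λ w → indicator (R? (i ∷ w)))) n ∎

Q≡T : ∀ {k} (n : Vector ℕ k) q m B → ∑ℕ n < B → + Q n q m ≡ T q B multinomialℤ n (threshold m)
Q≡T n q m B ∑<B = begin
  + Q n q m
    ≡⟨ length-filter-content (∑ℕ n) (λ w → ℓ m w ℕ.≤? q) n refl ⟩
  W (∑ℕ n) (λ w → indicator (ℓ m w ℕ.≤? q)) n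
    ≡⟨ W-cong (∑ℕ n) n (λ w → trans (indicator-⇔ (ℓ m w ℕ.≤? q) (long q w ℕ.≤? m) (ℓ≤⇔long≤ q m w)) (sym (D-threshold (long q w) m))) ⟩
  W (∑ℕ n) (λ w → D (long q w) (threshold m) 0) n
    ≡⟨ proj₁ (claim q B (∑ℕ n) ∑<B n refl (threshold m)) ⟩
  T q B multinomialℤ n (threshold m) ∎

-- The case m ≥ n

-- With all weights 1 the recursion of `W` is the multinomial recurrence. The assumption on `φ` is
-- restricted to length N so that length bounds can be used to verify it.
W-multinomial : ∀ {k} N (n : Vector ℕ k) → ∑ℕ n ≡ N → (φ : Word k → ℤ) →
                (∀ w → length w ≡ N → φ w ≡ 1ℤ) → W N φ n ≡ + multinomial n
W-multinomial zero n ∑≡ φ φ≗1 = trans (φ≗1 [] refl) (cong +_ (sym multinomial-n))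
  where
  multinomial-n : multinomial n ≡ 1
  multinomial-n = ℕ.m*n≡1⇒m≡1 _ (∏ℕ (λ i → n i !)) (trans (multinomial-∏! n) (cong _! ∑≡))
W-multinomial (suc N) n ∑≡ φ φ≗1 = trans
  (sum-cong-≗ (λ i → δ-cong-reduct i 1 n (λ {p} red → W-multinomial N p
    (ℕ.suc-injective (trans (sym (reduct-∑ red)) ∑≡)) (λ w → φ (i ∷ w)) (λ w len → φ≗1 (i ∷ w) (cong suc len)))))
  (sym (multinomial-rec n ∑≡))

-- A word has no more runs than letters, so with ∑ℕ n ≤ m every word satisfies the condition.
Q-all-words : ∀ {k} (n : Vector ℕ k) q m → ∑ℕ n ≤ m → Q n q m ≡ multinomial n
Q-all-words n q m ∑≤m = ℤ.+-injective (trans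
  (length-filter-content (∑ℕ n) (λ w → ℓ m w ℕ.≤? q) n refl)
  (W-multinomial (∑ℕ n) n refl _ (λ w len →
    indicator-true (ℓ m w ℕ.≤? q) (Equivalence.from (ℓ≤⇔long≤ q m w)
      (ℕ.≤-trans (long≤length q w) (ℕ.≤-trans (ℕ.≤-reflexive len) ∑≤m))))))

-- Binomial coefficients with integer arguments

pos-∸ : ∀ k u → + (k + u) - + k ≡ + u
pos-∸ k u = trans (cong (_- + k) (ℤ.pos-+ k u)) (cancel (+ k) (+ u))
  where
  cancel : ∀ x y → x ℤ.+ y - x ≡ y
  cancel = solve-∀

neg-∸ : ∀ m d → + m - + (m + suc d) ≡ -[1+ d ]
neg-∸ m d = trans (cong (λ x → + m - x) (ℤ.pos-+ m (suc d))) (cancel (+ m) (+ suc d))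
  where
  cancel : ∀ x y → x - (x ℤ.+ y) ≡ ℤ.- y
  cancel = solve-∀

-- The remainder equals (x - Q′) d and is smaller than d, which forces x = Q′.
/ℕ-exact : ∀ x d .{{_ : NonZero d}} → (x ℤ.* + d) ℤ./ℕ d ≡ x
/ℕ-exact x d = sym (ℤ.i-j≡0⇒i≡j x Q′ (ℤ.∣i∣≡0⇒i≡0 (ℕ.n<1⇒n≡0 (ℕ.*-cancelʳ-< d _ 1 small))))
  where
  Q′ : ℤ
  Q′ = (x ℤ.* + d) ℤ./ℕ d
  r : ℕ
  r = (x ℤ.* + d) ℤ.%ℕ d
  remainder : (x - Q′) ℤ.* + d ≡ + r
  remainder = trans (distrib x Q′ (+ d)) (trans (cong (_- Q′ ℤ.* + d) (ℤ.a≡a%ℕn+[a/ℕn]*n (x ℤ.* + d) d)) (cancel (+ r) (Q′ ℤ.* + d)))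
    where
    distrib : ∀ x y z → (x - y) ℤ.* z ≡ x ℤ.* z - y ℤ.* z
    distrib = solve-∀
    cancel : ∀ x y → x ℤ.+ y - y ≡ x
    cancel = solve-∀
  small : ℤ.∣ x - Q′ ∣ * d < 1 * d
  small = subst₂ _<_ (trans (sym (cong ℤ.∣_∣ remainder)) (ℤ.abs-* (x - Q′) (+ d))) (sym (ℕ.*-identityˡ d)) (ℤ.n%ℕd<d (x ℤ.* + d) d)

-- Stated over ℤ so that it covers a < b too, where both binomial coefficients are 0; the induction
-- then needs no case distinction on the sign of a - b.
C-absorb : ∀ a b → + (a C b) ℤ.* (+ a - + b) ≡ + (a C suc b) ℤ.* + suc b
C-absorb zero    zero    = refl
C-absorb zero    (suc b) rewrite k>n⇒nCk≡0 {0} {suc b} (s≤s z≤n) | k>n⇒nCk≡0 {0} {suc (suc b)} (s≤s z≤n) = refl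
C-absorb (suc a) zero    = begin
  + (suc a C 0) ℤ.* (+ suc a - 0ℤ)  ≡⟨ cong (λ x → + x ℤ.* (+ suc a - 0ℤ)) (C-0 (suc a)) ⟩
  1ℤ ℤ.* (+ suc a - 0ℤ)             ≡⟨ expand (+ a) ⟩
  1ℤ ℤ.+ 1ℤ ℤ.* (+ a - 0ℤ)          ≡⟨ cong (λ x → 1ℤ ℤ.+ + x ℤ.* (+ a - 0ℤ)) (C-0 a) ⟨
  1ℤ ℤ.+ + (a C 0) ℤ.* (+ a - 0ℤ)   ≡⟨ cong (ℤ._+_ 1ℤ) (C-absorb a 0) ⟩
  1ℤ ℤ.+ + (a C 1) ℤ.* 1ℤ           ≡⟨ factor (+ (a C 1)) ⟩
  (1ℤ ℤ.+ + (a C 1)) ℤ.* 1ℤ         ≡⟨ cong (λ x → (+ x ℤ.+ + (a C 1)) ℤ.* 1ℤ) (C-0 a) ⟨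
  + (a C 0 + a C 1) ℤ.* 1ℤ          ≡⟨ cong (λ x → + x ℤ.* 1ℤ) (C-suc a 0) ⟨
  + (suc a C 1) ℤ.* 1ℤ              ∎
  where
  expand : ∀ x → 1ℤ ℤ.* (1ℤ ℤ.+ x - 0ℤ) ≡ 1ℤ ℤ.+ 1ℤ ℤ.* (x - 0ℤ)
  expand = solve-∀
  factor : ∀ x → 1ℤ ℤ.+ x ℤ.* 1ℤ ≡ (1ℤ ℤ.+ x) ℤ.* 1ℤ
  factor = solve-∀
C-absorb (suc a) (suc b) = begin
  + (suc a C suc b) ℤ.* (+ suc a - + suc b)
    ≡⟨ cong (λ x → + x ℤ.* (+ suc a - + suc b)) (C-suc a b) ⟩
  (u ℤ.+ v) ℤ.* (+ suc a - + suc b)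
    ≡⟨ left u v (+ a) (+ b) ⟩
  u ℤ.* (+ a - + b) ℤ.+ v ℤ.* (+ a - + b)
    ≡⟨ cong (ℤ._+ v ℤ.* (+ a - + b)) (C-absorb a b) ⟩
  v ℤ.* + suc b ℤ.+ v ℤ.* (+ a - + b)
    ≡⟨ middle v (+ a) (+ b) ⟩
  v ℤ.* + suc (suc b) ℤ.+ v ℤ.* (+ a - + suc b)
    ≡⟨ cong (ℤ._+_ (v ℤ.* + suc (suc b))) (C-absorb a (suc b)) ⟩
  v ℤ.* + suc (suc b) ℤ.+ w ℤ.* + suc (suc b)
    ≡⟨ ℤ.*-distribʳ-+ (+ suc (suc b)) v w ⟨
  (v ℤ.+ w) ℤ.* + suc (suc b)
    ≡⟨ cong (λ x → + x ℤ.* + suc (suc b)) (C-suc a (suc b)) ⟨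
  + (suc a C suc (suc b)) ℤ.* + suc (suc b) ∎
  where
  u v w : ℤ
  u = + (a C b)
  v = + (a C suc b)
  w = + (a C suc (suc b))
  left : ∀ u v x y → (u ℤ.+ v) ℤ.* (1ℤ ℤ.+ x - (1ℤ ℤ.+ y)) ≡ u ℤ.* (x - y) ℤ.+ v ℤ.* (x - y)
  left = solve-∀
  middle : ∀ v x y → v ℤ.* (1ℤ ℤ.+ y) ℤ.+ v ℤ.* (x - y) ≡ v ℤ.* (1ℤ ℤ.+ (1ℤ ℤ.+ y)) ℤ.+ v ℤ.* (x - (1ℤ ℤ.+ y))
  middle = solve-∀

falling-pos : ∀ a b → falling (+ a) b ≡ + (a C b) ℤ.* + (b !)
falling-pos a zero    = sym (cong (λ x → + x ℤ.* 1ℤ) (C-0 a))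
falling-pos a (suc b) = begin
  falling (+ a) b ℤ.* (+ a - + b)               ≡⟨ cong (ℤ._* (+ a - + b)) (falling-pos a b) ⟩
  + (a C b) ℤ.* + (b !) ℤ.* (+ a - + b)         ≡⟨ swap (+ (a C b)) (+ (b !)) (+ a - + b) ⟩
  + (a C b) ℤ.* (+ a - + b) ℤ.* + (b !)         ≡⟨ cong (ℤ._* + (b !)) (C-absorb a b) ⟩
  + (a C suc b) ℤ.* + suc b ℤ.* + (b !)         ≡⟨ ℤ.*-assoc (+ (a C suc b)) (+ suc b) (+ (b !)) ⟩
  + (a C suc b) ℤ.* (+ suc b ℤ.* + (b !))       ≡⟨ cong (ℤ._*_ (+ (a C suc b))) (ℤ.pos-* (suc b) (b !)) ⟨
  + (a C suc b) ℤ.* + (suc b !)                 ∎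
  where
  swap : ∀ x y z → x ℤ.* y ℤ.* z ≡ x ℤ.* z ℤ.* y
  swap = solve-∀

binom-pos : ∀ a b → binom (+ a) (+ b) ≡ + (a C b)
binom-pos a b = trans (cong (λ x → (x ℤ./ℕ (b !)) {{b ℕ.!≢0}}) (falling-pos a b)) (/ℕ-exact (+ (a C b)) (b !) {{b ℕ.!≢0}})

falling-[-1] : ∀ b → falling -1ℤ b ≡ -1ℤ ^ b ℤ.* + (b !)
falling-[-1] zero    = refl
falling-[-1] (suc b) = begin
  falling -1ℤ b ℤ.* (-1ℤ - + b)              ≡⟨ cong (ℤ._* (-1ℤ - + b)) (falling-[-1] b) ⟩
  -1ℤ ^ b ℤ.* + (b !) ℤ.* (-1ℤ - + b)        ≡⟨ swap (-1ℤ ^ b) (+ (b !)) (+ b) ⟩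
  -1ℤ ℤ.* -1ℤ ^ b ℤ.* (+ suc b ℤ.* + (b !))  ≡⟨ cong (ℤ._*_ (-1ℤ ℤ.* -1ℤ ^ b)) (ℤ.pos-* (suc b) (b !)) ⟨
  -1ℤ ^ suc b ℤ.* + (suc b !)                ∎
  where
  swap : ∀ x y z → x ℤ.* y ℤ.* (-1ℤ - z) ≡ -1ℤ ℤ.* x ℤ.* ((1ℤ ℤ.+ z) ℤ.* y)
  swap = solve-∀

binom-[-1] : ∀ b → binom -1ℤ (+ b) ≡ -1ℤ ^ b
binom-[-1] b = trans (cong (λ x → (x ℤ./ℕ (b !)) {{b ℕ.!≢0}}) (falling-[-1] b)) (/ℕ-exact (-1ℤ ^ b) (b !) {{b ℕ.!≢0}})

sign² : ∀ e → -1ℤ ^ e ℤ.* -1ℤ ^ e ≡ 1ℤ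
sign² zero    = refl
sign² (suc e) = trans (square (-1ℤ ^ e)) (sign² e)
  where
  square : ∀ x → -1ℤ ℤ.* x ℤ.* (-1ℤ ℤ.* x) ≡ x ℤ.* x
  square = solve-∀

-- The exceptional value at j = 0 is absorbed by binom(-1, m) = (-1)^m, whose sign cancels the
-- prefactor.
threshold-binom : ∀ m j → threshold m j ≡ -1ℤ ^ (j + m) ℤ.* binom (+ j - 1ℤ) (+ m)
threshold-binom m zero    = sym (trans (cong (ℤ._*_ (-1ℤ ^ m)) (binom-[-1] m)) (sign² m))
threshold-binom m (suc j) = cong (ℤ._*_ (-1ℤ ^ (suc j + m))) (sym (binom-pos j m))

κ-binom : ∀ N p → 1 ≤ N → 1 ≤ p → + κ N p ≡ binom (+ N - 1ℤ) (+ p - 1ℤ)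
κ-binom (suc N) (suc p) _ _ = sym (binom-pos N p)

-- Sums over ranges and boxes

∑range-cong : ∀ lo hi {f g : ℕ → ℤ} → (∀ x → lo ≤ x → x ≤ hi → f x ≡ g x) → ∑range lo hi f ≡ ∑range lo hi g
∑range-cong lo hi {f} {g} f≗g = sum-cong-≗ (λ i → f≗g (lo + toℕ i) (ℕ.m≤m+n lo _) (bound (Fin.toℕ<n i)))
  where
  bound : ∀ {x} → x < suc hi ∸ lo → lo + x ≤ hi
  bound {x} x< = s≤s⁻¹ (subst (_≤ suc hi) (ℕ.+-suc lo x) (ℕ.≤-trans (ℕ.+-monoʳ-≤ lo x<) (ℕ.≤-reflexive (ℕ.m+[n∸m]≡n lo≤))))
    where
    lo≤ : lo ≤ suc hi
    lo≤ with lo ℕ.≤? suc hi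
    ... | yes p = p
    ... | no ¬p = contradiction (subst (suc x ≤_) (ℕ.m≤n⇒m∸n≡0 (ℕ.<⇒≤ (ℕ.≰⇒> ¬p))) x<) λ()

∑range-+ : ∀ lo hi (f g : ℕ → ℤ) → ∑range lo hi (λ x → f x ℤ.+ g x) ≡ ∑range lo hi f ℤ.+ ∑range lo hi g
∑range-+ lo hi f g = ∑-distrib-+ {suc hi ∸ lo} (λ i → f (lo + toℕ i)) (λ i → g (lo + toℕ i))

∑range-0 : ∀ lo hi → ∑range lo hi (λ _ → 0ℤ) ≡ 0ℤ
∑range-0 lo hi = sum-replicate-zero (suc hi ∸ lo)

Box : ∀ {k} → Vector ℕ k → Vector ℕ k → Vector ℕ k → Set
Box lo hi p = ∀ i → lo i ≤ p i × p i ≤ hi i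

∑box-cong : ∀ {k} (lo hi : Vector ℕ k) {f g} → (∀ p → Box lo hi p → f p ≡ g p) → ∑box lo hi f ≡ ∑box lo hi g
∑box-cong {zero}  lo hi f≗g = f≗g Vector.[] λ()
∑box-cong {suc k} lo hi f≗g = ∑range-cong (head lo) (head hi) (λ x lo≤x x≤hi →
  ∑box-cong (tail lo) (tail hi) (λ p box → f≗g (x Vector.∷ p) λ { zero → lo≤x , x≤hi ; (suc i) → box i }))

∑box-+ : ∀ {k} (lo hi : Vector ℕ k) f g → ∑box lo hi (λ p → f p ℤ.+ g p) ≡ ∑box lo hi f ℤ.+ ∑box lo hi g
∑box-+ {zero}  lo hi f g = refl
∑box-+ {suc k} lo hi f g = trans
  (∑range-cong (head lo) (head hi) (λ x _ _ → ∑box-+ (tail lo) (tail hi) (λ p → f (x Vector.∷ p)) (λ p → g (x Vector.∷ p))))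
  (∑range-+ (head lo) (head hi) (λ x → ∑box (tail lo) (tail hi) (λ p → f (x Vector.∷ p))) (λ x → ∑box (tail lo) (tail hi) (λ p → g (x Vector.∷ p))))

∑box-0 : ∀ {k} (lo hi : Vector ℕ k) → ∑box lo hi (λ _ → 0ℤ) ≡ 0ℤ
∑box-0 {zero}  lo hi = refl
∑box-0 {suc k} lo hi = trans (∑range-cong (head lo) (head hi) (λ _ _ _ → ∑box-0 (tail lo) (tail hi))) (∑range-0 (head lo) (head hi))

∑range-*ˡ : ∀ lo hi c f → c ℤ.* ∑range lo hi f ≡ ∑range lo hi (λ x → c ℤ.* f x)
∑range-*ˡ lo hi c f = begin
  c ℤ.* ∑range lo hi f                      ≡⟨ cong (ℤ._*_ c) (∑<≡∑ d (λ x → f (lo + x))) ⟨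
  c ℤ.* ∑< d (λ x → f (lo + x))             ≡⟨ ∑<-*ˡ d c (λ x → f (lo + x)) ⟩
  ∑< d (λ x → c ℤ.* f (lo + x))             ≡⟨ ∑<≡∑ d (λ x → c ℤ.* f (lo + x)) ⟩
  ∑range lo hi (λ x → c ℤ.* f x)            ∎
  where
  d : ℕ
  d = suc hi ∸ lo

∑box-*ˡ : ∀ {k} (lo hi : Vector ℕ k) c f → c ℤ.* ∑box lo hi f ≡ ∑box lo hi (λ p → c ℤ.* f p)
∑box-*ˡ {zero}  lo hi c f = refl
∑box-*ˡ {suc k} lo hi c f = trans
  (∑range-*ˡ (head lo) (head hi) c (λ x → ∑box (tail lo) (tail hi) (λ p → f (x Vector.∷ p))))
  (∑range-cong (head lo) (head hi) (λ x _ _ → ∑box-*ˡ (tail lo) (tail hi) c (λ p → f (x Vector.∷ p))))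

∑<-∑box : ∀ {k} B (lo hi : Vector ℕ k) (f : ℕ → Vector ℕ k → ℤ) →
          ∑< B (λ j → ∑box lo hi (f j)) ≡ ∑box lo hi (λ p → ∑< B (λ j → f j p))
∑<-∑box zero    lo hi f = sym (∑box-0 lo hi)
∑<-∑box (suc B) lo hi f = trans (cong (ℤ._+_ (∑box lo hi (f 0))) (∑<-∑box B lo hi (f ∘ suc)))
  (sym (∑box-+ lo hi (f 0) (λ p → ∑< B (λ j → f (suc j) p))))

∑range-∑box : ∀ {k} a b (lo hi : Vector ℕ k) (f : ℕ → Vector ℕ k → ℤ) →
              ∑range a b (λ j → ∑box lo hi (f j)) ≡ ∑box lo hi (λ p → ∑range a b (λ j → f j p))
∑range-∑box a b lo hi f = begin
  ∑range a b (λ j → ∑box lo hi (f j))                 ≡⟨ ∑<≡∑ d (λ j → ∑box lo hi (f (a + j))) ⟨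
  ∑< d (λ j → ∑box lo hi (f (a + j)))                 ≡⟨ ∑<-∑box d lo hi (λ j → f (a + j)) ⟩
  ∑box lo hi (λ p → ∑< d (λ j → f (a + j) p))         ≡⟨ ∑box-cong lo hi (λ p _ → ∑<≡∑ d (λ j → f (a + j) p)) ⟩
  ∑box lo hi (λ p → ∑range a b (λ j → f j p))         ∎
  where
  d : ℕ
  d = suc b ∸ a

-- The case q > 0

coeff-0-p : ∀ q n j → 1 ≤ n → coeff q n 0 j ≡ 0ℤ
coeff-0-p q (suc n) j _ = coeff-suc-0-0 q n j

-- Since p = 0 and p > n contribute nothing, the sum over p can be
-- restricted to 1 ≤ p ≤ n.
K-∑range : ∀ q B n X → 1 ≤ n → n < B → K q B n X ≡ ∑range 1 n (λ p → row q B n p (X p))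
K-∑range q B n X 1≤n n<B = ∑<-∑range B 1 n (λ p → row q B n p (X p)) n<B
  (λ { zero _ → ∑<-zero B (λ j _ → cong (ℤ._* X 0 j) (coeff-0-p q n j 1≤n)) ; (suc p) (s≤s ()) })
  (λ p n<p → ∑<-zero B (λ j _ → cong (ℤ._* X p j) (coeff-big-p q {n} {p} {j} n<p)))

-- For such j the leftover exponent M = n - j (q + 1) exceeds p, so `p C M` vanishes.
j-below : ∀ n p j q → j < ⌈ (n ∸ p) / suc q ⌉ → coeff q n p j ≡ 0ℤ
j-below n p j q j<lo = shift-zero (j * suc q) n λ M n≡ → trans
  (cong (λ x → -1ℤ ^ (M + j + p) ℤ.* + (κ (M + j) p * x)) (k>n⇒nCk≡0 (ℕ.≰⇒> (M≰p M n≡))))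
  (trans (cong (λ x → -1ℤ ^ (M + j + p) ℤ.* + x) (ℕ.*-zeroʳ (κ (M + j) p))) (ℤ.*-zeroʳ (-1ℤ ^ (M + j + p))))
  where
  M≰p : ∀ M → n ≡ j * suc q + M → ¬ M ≤ p
  -- If M ≤ p, then n - p + q < (j + 1) (q + 1), so the quotient rounded up is at most j.
  M≰p M n≡ M≤p = ℕ.<⇒≱ j<lo (s≤s⁻¹ (m<n*o⇒m/o<n (subst (n ∸ p + q <_) (ℕ.+-comm (j * suc q) (suc q))
    (ℕ.≤-<-trans (ℕ.+-monoˡ-≤ q n∸p≤) (ℕ.+-monoʳ-< (j * suc q) (ℕ.n<1+n q))))))
    where
    n∸p≤ : n ∸ p ≤ j * suc q
    n∸p≤ = ℕ.≤-trans (ℕ.≤-reflexive (cong (_∸ p) n≡))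
      (ℕ.≤-trans (ℕ.∸-monoˡ-≤ p (ℕ.+-monoʳ-≤ (j * suc q) M≤p)) (ℕ.≤-reflexive (ℕ.m+n∸n≡m (j * suc q) p)))

j*[1+q]+M : ∀ j q M → j * suc q + M ≡ q * j + (M + j)
j*[1+q]+M j q M = begin
  j * suc q + M     ≡⟨ cong (_+ M) (trans (ℕ.*-suc j q) (ℕ.+-comm j (j * q))) ⟩
  j * q + j + M     ≡⟨ ℕ.+-assoc (j * q) j M ⟩
  j * q + (j + M)   ≡⟨ cong₂ _+_ (ℕ.*-comm j q) (ℕ.+-comm j M) ⟩
  q * j + (M + j)   ∎

-- For such j the number M + j = n - q j is below p, so there is no composition into p parts and `κ`
-- vanishes.
j-above : ∀ n p j q .{{_ : NonZero q}} → ⌊ (n ∸ p) / q ⌋ < j → coeff q n p j ≡ 0ℤ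
j-above n p j q hi<j = shift-zero (j * suc q) n λ M n≡ → β-big-p q {M} {p} {j} (ℕ.≰⇒> (p≰M+j M n≡))
  where
  p≰M+j : ∀ M → n ≡ j * suc q + M → ¬ p ≤ M + j
  p≰M+j M n≡ p≤M+j = ℕ.<⇒≱ hi<j (ℕ.≤-trans (ℕ.≤-reflexive (sym (m*n/n≡m j q))) (/-monoˡ-≤ q j*q≤n∸p))
    where
    j*q≤n∸p : j * q ≤ n ∸ p
    j*q≤n∸p = ℕ.m+n≤o⇒m≤o∸n (j * q) (subst (j * q + p ≤_) (sym (trans n≡ (j*[1+q]+M j q M)))
      (ℕ.+-mono-≤ (ℕ.≤-reflexive (ℕ.*-comm j q)) p≤M+j))

module _ (q : ℕ) .{{_ : NonZero q}} where

  jLo jHi : ∀ {k} → Vector ℕ k → Vector ℕ k → Vector ℕ k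
  jLo n p i = ⌈ (n i ∸ p i) / suc q ⌉
  jHi n p i = ⌊ (n i ∸ p i) / q ⌋

  -- `T` nests its sums as p₁, j₁, p₂, j₂ and so on, whereas the formula takes all pᵢ before all jᵢ.
  -- The exchange is possible because the range of jᵢ depends on pᵢ only.
  T-∑box : ∀ {k} B Φ (n : Vector ℕ k) c → (∀ i → 1 ≤ n i) → (∀ i → n i < B) →
    T q B Φ n c ≡ ∑box (λ _ → 1) n (λ p → Φ p ℤ.*
      ∑box (jLo n p) (jHi n p) (λ j → c (∑ℕ j) ℤ.* ∏ℤ (λ i → coeff q (n i) (p i) (j i))))
  T-∑box {zero}  B Φ n c 1≤n n<B = cong (ℤ._*_ (Φ Vector.[])) (sym (ℤ.*-identityʳ (c 0)))
  T-∑box {suc k} B Φ n c 1≤n n<B = trans (K-∑range q B n₀ X (1≤n zero) (n<B zero))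
    (∑range-cong 1 n₀ (λ p _ p≤n₀ → slice p))
    where
    n₀ : ℕ
    n₀ = head n
    t : Vector ℕ k
    t = tail n
    X : ℕ → ℕ → ℤ
    X p j = T q B (λ p′ → Φ (p Vector.∷ p′)) t (λ s → c (j + s))
    ∏a : Vector ℕ k → Vector ℕ k → ℤ
    ∏a p′ j′ = ∏ℤ (λ i → coeff q (t i) (p′ i) (j′ i))
    slice : ∀ p → row q B n₀ p (X p) ≡ ∑box (λ _ → 1) t (λ p′ → Φ (p Vector.∷ p′) ℤ.*
      ∑range ⌈ (n₀ ∸ p) / suc q ⌉ ⌊ (n₀ ∸ p) / q ⌋ (λ j → ∑box (jLo t p′) (jHi t p′) (λ j′ →
        c (j + ∑ℕ j′) ℤ.* (coeff q n₀ p j ℤ.* ∏a p′ j′))))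
    slice p = begin
      row q B n₀ p (X p)
        ≡⟨ ∑<-∑range B lo hi (λ j → coeff q n₀ p j ℤ.* X p j)
             (ℕ.≤-<-trans (m/n≤m (n₀ ∸ p) q) (ℕ.≤-<-trans (ℕ.m∸n≤m n₀ p) (n<B zero)))
             (λ j j<lo → cong (ℤ._* X p j) (j-below n₀ p j q j<lo))
             (λ j hi<j → cong (ℤ._* X p j) (j-above n₀ p j q hi<j)) ⟩
      ∑range lo hi (λ j → coeff q n₀ p j ℤ.* X p j)
        ≡⟨ ∑range-cong lo hi (λ j _ _ → trans
             (cong (ℤ._*_ (coeff q n₀ p j)) (T-∑box B Φ′ t (λ s → c (j + s)) (1≤n ∘ suc) (n<B ∘ suc)))
             (∑box-*ˡ (λ _ → 1) t (coeff q n₀ p j) (λ p′ → Φ′ p′ ℤ.* Y j p′))) ⟩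
      ∑range lo hi (λ j → ∑box (λ _ → 1) t (λ p′ → coeff q n₀ p j ℤ.* (Φ′ p′ ℤ.* Y j p′)))
        ≡⟨ ∑range-∑box lo hi (λ _ → 1) t (λ j p′ → coeff q n₀ p j ℤ.* (Φ′ p′ ℤ.* Y j p′)) ⟩
      ∑box (λ _ → 1) t (λ p′ → ∑range lo hi (λ j → coeff q n₀ p j ℤ.* (Φ′ p′ ℤ.* Y j p′)))
        ≡⟨ ∑box-cong (λ _ → 1) t (λ p′ _ → trans
             (∑range-cong lo hi (λ j _ _ → merge j p′))
             (sym (∑range-*ˡ lo hi (Φ′ p′) (λ j → ∑box (jLo t p′) (jHi t p′) (λ j′ → c (j + ∑ℕ j′) ℤ.* (coeff q n₀ p j ℤ.* ∏a p′ j′)))))) ⟩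
      ∑box (λ _ → 1) t (λ p′ → Φ′ p′ ℤ.* ∑range lo hi (λ j → ∑box (jLo t p′) (jHi t p′) (λ j′ →
        c (j + ∑ℕ j′) ℤ.* (coeff q n₀ p j ℤ.* ∏a p′ j′)))) ∎
      where
      lo hi : ℕ
      lo = ⌈ (n₀ ∸ p) / suc q ⌉
      hi = ⌊ (n₀ ∸ p) / q ⌋
      Φ′ : Vector ℕ k → ℤ
      Φ′ p′ = Φ (p Vector.∷ p′)
      Y : ℕ → Vector ℕ k → ℤ
      Y j p′ = ∑box (jLo t p′) (jHi t p′) (λ j′ → c (j + ∑ℕ j′) ℤ.* ∏a p′ j′)
      swap : ∀ x y z → x ℤ.* (y ℤ.* z) ≡ y ℤ.* (x ℤ.* z)
      swap = solve-∀
      merge : ∀ j p′ → coeff q n₀ p j ℤ.* (Φ′ p′ ℤ.* Y j p′)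
              ≡ Φ′ p′ ℤ.* ∑box (jLo t p′) (jHi t p′) (λ j′ → c (j + ∑ℕ j′) ℤ.* (coeff q n₀ p j ℤ.* ∏a p′ j′))
      merge j p′ = trans (swap (coeff q n₀ p j) (Φ′ p′) (Y j p′)) (cong (ℤ._*_ (Φ′ p′)) (trans
        (∑box-*ˡ (jLo t p′) (jHi t p′) (coeff q n₀ p j) (λ j′ → c (j + ∑ℕ j′) ℤ.* ∏a p′ j′))
        (∑box-cong (jLo t p′) (jHi t p′) (λ j′ _ → swap (coeff q n₀ p j) (c (j + ∑ℕ j′)) (∏a p′ j′)))))

  binomials : ℕ → ℕ → ℕ → ℤ
  binomials n p j = binom (+ n - + (q * j) - 1ℤ) (+ p - 1ℤ) ℤ.* binom (+ p) (+ n - + (q * j) - + j)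

  -- With N = n - q j = M + j the sign in `β` is (-1)^(N+p). Replacing N by n + q j keeps the parity
  -- and lets the sign factor over n, j and p.
  coeff-binom : ∀ n p j → 1 ≤ p → p ≤ n → j ≤ ⌊ (n ∸ p) / q ⌋ → coeff q n p j ≡ -1ℤ ^ (n + q * j + p) ℤ.* binomials n p j
  coeff-binom n p j 1≤p p≤n j≤hi = helper (n ∸ q * j) (sym (ℕ.m+[n∸m]≡n (ℕ.m+n≤o⇒m≤o (q * j) q*j+p≤n)))
    where
    q*j+p≤n : q * j + p ≤ n
    q*j+p≤n = subst (_≤ n) (ℕ.+-comm p (q * j)) (ℕ.≤-trans (ℕ.+-monoʳ-≤ p
      (ℕ.≤-trans (ℕ.≤-reflexive (ℕ.*-comm q j)) (ℕ.≤-trans (ℕ.*-monoˡ-≤ q j≤hi) (m/n*n≤m (n ∸ p) q))))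
      (ℕ.≤-reflexive (ℕ.m+[n∸m]≡n p≤n)))
    helper : ∀ N → n ≡ q * j + N → coeff q n p j ≡ -1ℤ ^ (n + q * j + p) ℤ.* binomials n p j
    helper N refl with j ℕ.≤? N
    ... | yes j≤N = begin
      coeff q (q * j + N) p j                        ≡⟨ cong (λ x → coeff q x p j) n≡ ⟩
      shift (j * suc q) (λ M → β M p j) (j * suc q + (N ∸ j)) ≡⟨ shift-at (j * suc q) ⟩
      β (N ∸ j) p j
        ≡⟨ cong (λ x → -1ℤ ^ (x + p) ℤ.* + (κ x p * (p C (N ∸ j)))) (ℕ.m∸n+n≡m j≤N) ⟩
      -1ℤ ^ (N + p) ℤ.* + (κ N p * (p C (N ∸ j)))
        ≡⟨ cong₂ ℤ._*_ sign (trans (ℤ.pos-* (κ N p) (p C (N ∸ j))) (cong₂ ℤ._*_ first second)) ⟩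
      -1ℤ ^ (q * j + N + q * j + p) ℤ.* binomials (q * j + N) p j ∎
      where
      n≡ : q * j + N ≡ j * suc q + (N ∸ j)
      n≡ = sym (trans (j*[1+q]+M j q (N ∸ j)) (cong (_+_ (q * j)) (ℕ.m∸n+n≡m j≤N)))
      shift-at : ∀ r {f x} → shift r f (r + x) ≡ f x
      shift-at zero    = refl
      shift-at (suc r) = shift-at r
      1≤N : 1 ≤ N
      1≤N = ℕ.≤-trans 1≤p (ℕ.+-cancelˡ-≤ (q * j) p N q*j+p≤n)
      first : + κ N p ≡ binom (+ (q * j + N) - + (q * j) - 1ℤ) (+ p - 1ℤ)
      first = trans (κ-binom N p 1≤N 1≤p) (cong (λ x → binom (x - 1ℤ) (+ p - 1ℤ)) (sym (pos-∸ (q * j) N)))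
      second : + (p C (N ∸ j)) ≡ binom (+ p) (+ (q * j + N) - + (q * j) - + j)
      second = trans (sym (binom-pos p (N ∸ j))) (cong (binom (+ p)) (sym (trans
        (cong (_- + j) (pos-∸ (q * j) N)) (trans (cong (λ x → + x - + j) (sym (ℕ.m+[n∸m]≡n j≤N))) (pos-∸ j (N ∸ j))))))
      sign : -1ℤ ^ (N + p) ≡ -1ℤ ^ (q * j + N + q * j + p)
      sign = sym (begin
        -1ℤ ^ (q * j + N + q * j + p)
          ≡⟨ ℤ.^-distribˡ-+-* -1ℤ (q * j + N + q * j) p ⟩
        -1ℤ ^ (q * j + N + q * j) ℤ.* -1ℤ ^ p
          ≡⟨ cong (ℤ._* -1ℤ ^ p) (ℤ.^-distribˡ-+-* -1ℤ (q * j + N) (q * j)) ⟩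
        -1ℤ ^ (q * j + N) ℤ.* -1ℤ ^ (q * j) ℤ.* -1ℤ ^ p
          ≡⟨ cong (λ x → x ℤ.* -1ℤ ^ (q * j) ℤ.* -1ℤ ^ p) (ℤ.^-distribˡ-+-* -1ℤ (q * j) N) ⟩
        -1ℤ ^ (q * j) ℤ.* -1ℤ ^ N ℤ.* -1ℤ ^ (q * j) ℤ.* -1ℤ ^ p
          ≡⟨ regroup (-1ℤ ^ (q * j)) (-1ℤ ^ N) (-1ℤ ^ p) ⟩
        -1ℤ ^ (q * j) ℤ.* -1ℤ ^ (q * j) ℤ.* (-1ℤ ^ N ℤ.* -1ℤ ^ p)
          ≡⟨ cong₂ ℤ._*_ (sign² (q * j)) (sym (ℤ.^-distribˡ-+-* -1ℤ N p)) ⟩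
        1ℤ ℤ.* -1ℤ ^ (N + p)
          ≡⟨ ℤ.*-identityˡ _ ⟩
        -1ℤ ^ (N + p) ∎)
        where
        regroup : ∀ x y z → x ℤ.* y ℤ.* x ℤ.* z ≡ x ℤ.* x ℤ.* (y ℤ.* z)
        regroup = solve-∀
    -- The upper bound on j ensures only q j + p ≤ n, so n - q j - j can be negative. The shift then
    -- gives 0, as does `binom` with a negative lower index.
    ... | no j≰N = trans
      (shift-zero (j * suc q) (q * j + N) λ M n≡ → contradiction
        (ℕ.≤-trans (ℕ.m≤n+m j M) (ℕ.≤-reflexive (sym (ℕ.+-cancelˡ-≡ (q * j) N (M + j) (trans n≡ (j*[1+q]+M j q M)))))) j≰N)
      (sym (trans (cong (λ x → -1ℤ ^ (q * j + N + q * j + p) ℤ.* (u ℤ.* x)) negative)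
        (trans (cong (ℤ._*_ (-1ℤ ^ (q * j + N + q * j + p))) (ℤ.*-zeroʳ u)) (ℤ.*-zeroʳ (-1ℤ ^ (q * j + N + q * j + p))))))
      where
      u : ℤ
      u = binom (+ (q * j + N) - + (q * j) - 1ℤ) (+ p - 1ℤ)
      negative : binom (+ p) (+ (q * j + N) - + (q * j) - + j) ≡ 0ℤ
      negative = cong (binom (+ p)) (trans (cong (_- + j) (pos-∸ (q * j) N))
        (trans (cong (λ x → + N - + x) (sym (trans (ℕ.+-suc N (j ∸ suc N)) (ℕ.m+[n∸m]≡n (ℕ.≰⇒> j≰N))))) (neg-∸ N (j ∸ suc N))))

  ∏-signs : ∀ {k} (n p j : Vector ℕ k) →
    ∏ℤ (λ i → -1ℤ ^ (n i + q * j i + p i)) ≡ -1ℤ ^ ∑ℕ n ℤ.* -1ℤ ^ (q * ∑ℕ j) ℤ.* -1ℤ ^ ∑ℕ p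
  ∏-signs {zero}  n p j rewrite ℕ.*-zeroʳ q = refl
  ∏-signs {suc k} n p j = begin
    -1ℤ ^ (x + q * y + z) ℤ.* ∏ℤ (λ i → -1ℤ ^ (tail n i + q * tail j i + tail p i))
      ≡⟨ cong₂ ℤ._*_ (trans (ℤ.^-distribˡ-+-* -1ℤ (x + q * y) z) (cong (ℤ._* -1ℤ ^ z) (ℤ.^-distribˡ-+-* -1ℤ x (q * y))))
           (∏-signs (tail n) (tail p) (tail j)) ⟩
    -1ℤ ^ x ℤ.* -1ℤ ^ (q * y) ℤ.* -1ℤ ^ z ℤ.* (-1ℤ ^ x′ ℤ.* -1ℤ ^ (q * y′) ℤ.* -1ℤ ^ z′)
      ≡⟨ regroup (-1ℤ ^ x) (-1ℤ ^ (q * y)) (-1ℤ ^ z) (-1ℤ ^ x′) (-1ℤ ^ (q * y′)) (-1ℤ ^ z′) ⟩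
    -1ℤ ^ x ℤ.* -1ℤ ^ x′ ℤ.* (-1ℤ ^ (q * y) ℤ.* -1ℤ ^ (q * y′)) ℤ.* (-1ℤ ^ z ℤ.* -1ℤ ^ z′)
      ≡⟨ cong₂ ℤ._*_ (cong₂ ℤ._*_ (ℤ.^-distribˡ-+-* -1ℤ x x′)
           (trans (cong (-1ℤ ^_) (ℕ.*-distribˡ-+ q y y′)) (ℤ.^-distribˡ-+-* -1ℤ (q * y) (q * y′)))) (ℤ.^-distribˡ-+-* -1ℤ z z′) ⟨
    -1ℤ ^ ∑ℕ n ℤ.* -1ℤ ^ (q * ∑ℕ j) ℤ.* -1ℤ ^ ∑ℕ p ∎
    where
    x y z x′ y′ z′ : ℕ
    x = head n
    y = head j
    z = head p
    x′ = ∑ℕ (tail n)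
    y′ = ∑ℕ (tail j)
    z′ = ∑ℕ (tail p)
    regroup : ∀ a b c d e f → a ℤ.* b ℤ.* c ℤ.* (d ℤ.* e ℤ.* f) ≡ a ℤ.* d ℤ.* (b ℤ.* e) ℤ.* (c ℤ.* f)
    regroup = solve-∀

  -- Signs are collected: with J = ∑ℕ j, the (-1)^J from `threshold` joins the (-1)^(q J) from the
  -- letters to form (-1)^(J (q+1)).
  summand : ∀ {k} m (n p j : Vector ℕ k) → Box (λ _ → 1) n p → Box (jLo n p) (jHi n p) j →
    threshold m (∑ℕ j) ℤ.* ∏ℤ (λ i → coeff q (n i) (p i) (j i))
    ≡ -1ℤ ^ (∑ℕ n + m) ℤ.* -1ℤ ^ ∑ℕ p ℤ.*
      (-1ℤ ^ (∑ℕ j * suc q) ℤ.* binom (+ ∑ℕ j - 1ℤ) (+ m) ℤ.* ∏ℤ (λ i → binomials (n i) (p i) (j i)))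
  summand m n p j p∈ j∈ = begin
    threshold m J ℤ.* ∏ℤ (λ i → coeff q (n i) (p i) (j i))
      ≡⟨ cong₂ ℤ._*_ (threshold-binom m J) (trans
           (∏-cong (λ i → coeff-binom (n i) (p i) (j i) (proj₁ (p∈ i)) (proj₂ (p∈ i)) (proj₂ (j∈ i))))
           (∏-distrib-* (λ i → -1ℤ ^ (n i + q * j i + p i)) (λ i → binomials (n i) (p i) (j i)))) ⟩
    -1ℤ ^ (J + m) ℤ.* b ℤ.* (∏ℤ (λ i → -1ℤ ^ (n i + q * j i + p i)) ℤ.* Π)
      ≡⟨ cong₂ (λ x y → x ℤ.* b ℤ.* (y ℤ.* Π)) (ℤ.^-distribˡ-+-* -1ℤ J m) (∏-signs n p j) ⟩
    -1ℤ ^ J ℤ.* -1ℤ ^ m ℤ.* b ℤ.* (-1ℤ ^ N ℤ.* -1ℤ ^ (q * J) ℤ.* -1ℤ ^ P ℤ.* Π)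
      ≡⟨ regroup (-1ℤ ^ J) (-1ℤ ^ m) b (-1ℤ ^ N) (-1ℤ ^ (q * J)) (-1ℤ ^ P) Π ⟩
    -1ℤ ^ N ℤ.* -1ℤ ^ m ℤ.* -1ℤ ^ P ℤ.* (-1ℤ ^ J ℤ.* -1ℤ ^ (q * J) ℤ.* b ℤ.* Π)
      ≡⟨ cong₂ (λ x y → x ℤ.* -1ℤ ^ P ℤ.* (y ℤ.* b ℤ.* Π)) (ℤ.^-distribˡ-+-* -1ℤ N m)
           (trans (cong (-1ℤ ^_) (trans (ℕ.*-suc J q) (cong (_+_ J) (ℕ.*-comm J q)))) (ℤ.^-distribˡ-+-* -1ℤ J (q * J))) ⟨
    -1ℤ ^ (N + m) ℤ.* -1ℤ ^ P ℤ.* (-1ℤ ^ (J * suc q) ℤ.* b ℤ.* Π) ∎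
    where
    N P J : ℕ
    N = ∑ℕ n
    P = ∑ℕ p
    J = ∑ℕ j
    b Π : ℤ
    b = binom (+ J - 1ℤ) (+ m)
    Π = ∏ℤ (λ i → binomials (n i) (p i) (j i))
    regroup : ∀ a b c d e f g → a ℤ.* b ℤ.* c ℤ.* (d ℤ.* e ℤ.* f ℤ.* g) ≡ d ℤ.* b ℤ.* f ℤ.* (a ℤ.* e ℤ.* c ℤ.* g)
    regroup = solve-∀

Q-formula : ∀ {k} q .{{_ : NonZero q}} m (n : Vector ℕ k) → (∀ i → 1 ≤ n i) →
  + Q n q m ≡ -1ℤ ^ (∑ℕ n + m) ℤ.* ∑box (λ _ → 1) n (λ p → -1ℤ ^ ∑ℕ p ℤ.* + multinomial p ℤ.*
    ∑box (λ i → ⌈ (n i ∸ p i) / suc q ⌉) (λ i → ⌊ (n i ∸ p i) / q ⌋) (λ j →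
      -1ℤ ^ (∑ℕ j * suc q) ℤ.* binom (+ ∑ℕ j - 1ℤ) (+ m) ℤ.*
      ∏ℤ (λ i → binom (+ n i - + (q * j i) - 1ℤ) (+ p i - 1ℤ) ℤ.* binom (+ p i) (+ n i - + (q * j i) - + j i))))
Q-formula q m n 1≤n = begin
  + Q n q m                        ≡⟨ Q≡T n q m B (ℕ.n<1+n _) ⟩
  T q B multinomialℤ n (threshold m)          ≡⟨ T-∑box q B multinomialℤ n (threshold m) 1≤n (λ i → s≤s (component≤∑ n i)) ⟩
  ∑box (λ _ → 1) n (λ p → multinomialℤ p ℤ.* ∑box (lo p) (hi p) (λ j → threshold m (∑ℕ j) ℤ.* ∏ℤ (λ i → coeff q (n i) (p i) (j i))))
    ≡⟨ ∑box-cong (λ _ → 1) n (λ p p∈ → begin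
         multinomialℤ p ℤ.* ∑box (lo p) (hi p) (λ j → threshold m (∑ℕ j) ℤ.* ∏ℤ (λ i → coeff q (n i) (p i) (j i)))
           ≡⟨ cong (ℤ._*_ (multinomialℤ p)) (∑box-cong (lo p) (hi p) (λ j j∈ → summand q m n p j p∈ j∈)) ⟩
         multinomialℤ p ℤ.* ∑box (lo p) (hi p) (λ j → s ℤ.* -1ℤ ^ ∑ℕ p ℤ.* term p j)
           ≡⟨ cong (ℤ._*_ (multinomialℤ p)) (∑box-*ˡ (lo p) (hi p) (s ℤ.* -1ℤ ^ ∑ℕ p) (term p)) ⟨
         multinomialℤ p ℤ.* (s ℤ.* -1ℤ ^ ∑ℕ p ℤ.* ∑box (lo p) (hi p) (term p))
           ≡⟨ regroup (multinomialℤ p) s (-1ℤ ^ ∑ℕ p) (∑box (lo p) (hi p) (term p)) ⟩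
         s ℤ.* (-1ℤ ^ ∑ℕ p ℤ.* multinomialℤ p ℤ.* ∑box (lo p) (hi p) (term p)) ∎) ⟩
  ∑box (λ _ → 1) n (λ p → s ℤ.* (-1ℤ ^ ∑ℕ p ℤ.* multinomialℤ p ℤ.* ∑box (lo p) (hi p) (term p)))
    ≡⟨ ∑box-*ˡ (λ _ → 1) n s (λ p → -1ℤ ^ ∑ℕ p ℤ.* multinomialℤ p ℤ.* ∑box (lo p) (hi p) (term p)) ⟨
  s ℤ.* ∑box (λ _ → 1) n (λ p → -1ℤ ^ ∑ℕ p ℤ.* multinomialℤ p ℤ.* ∑box (lo p) (hi p) (term p)) ∎
  where
  B : ℕ
  B = suc (∑ℕ n)
  lo hi : Vector ℕ _ → Vector ℕ _
  lo = jLo q n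
  hi = jHi q n
  s : ℤ
  s = -1ℤ ^ (∑ℕ n + m)
  term : Vector ℕ _ → Vector ℕ _ → ℤ
  term p j = -1ℤ ^ (∑ℕ j * suc q) ℤ.* binom (+ ∑ℕ j - 1ℤ) (+ m) ℤ.* ∏ℤ (λ i → binomials q (n i) (p i) (j i))
  regroup : ∀ a b c d → a ℤ.* (b ℤ.* c ℤ.* d) ≡ b ℤ.* (c ℤ.* a ℤ.* d)
  regroup = solve-∀

-- The case q = 0

-- For q = 0 the argument M + j of `κ` is n, independent of j, so sign and `κ` leave the sum over j.
coeff₀ : ∀ n p j → coeff 0 n p j ≡ -1ℤ ^ (n + p) ℤ.* + κ n p ℤ.* shift j (λ M → + (p C M)) n
coeff₀ n p j = trans (cong (λ r → shift r (λ M → β M p j) n) (ℕ.*-identityʳ j)) (helper j n)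
  where
  helper : ∀ j n → shift j (λ M → β M p j) n ≡ -1ℤ ^ (n + p) ℤ.* + κ n p ℤ.* shift j (λ M → + (p C M)) n
  helper j n with shift-view j n
  ... | inj₁ (_ , z) = trans (z _) (sym (trans (cong (ℤ._*_ s) (z _)) (ℤ.*-zeroʳ s)))
    where
    s : ℤ
    s = -1ℤ ^ (n + p) ℤ.* + κ n p
  ... | inj₂ (M , refl , at) = begin
    shift j (λ M → β M p j) (j + M)                         ≡⟨ at _ ⟩
    β M p j                                                 ≡⟨ cong (λ x → -1ℤ ^ (x + p) ℤ.* + (κ x p * (p C M))) (ℕ.+-comm M j) ⟩
    s ℤ.* + (κ (j + M) p * (p C M))                         ≡⟨ cong (ℤ._*_ s) (ℤ.pos-* (κ (j + M) p) (p C M)) ⟩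
    s ℤ.* (+ κ (j + M) p ℤ.* + (p C M))                     ≡⟨ ℤ.*-assoc s (+ κ (j + M) p) (+ (p C M)) ⟨
    s ℤ.* + κ (j + M) p ℤ.* + (p C M)                       ≡⟨ cong (ℤ._*_ (s ℤ.* + κ (j + M) p)) (at _) ⟨
    s ℤ.* + κ (j + M) p ℤ.* shift j (λ M → + (p C M)) (j + M) ∎
    where
    s : ℤ
    s = -1ℤ ^ (j + M + p)

shift-suc : ∀ j n f → shift j (λ M → f M ℤ.+ shift 1 f M) (suc n) ≡ shift j f (suc n) ℤ.+ shift j f n
shift-suc j n f = trans (shift-+ j (suc n) f (shift 1 f)) (cong (ℤ._+_ (shift j f (suc n))) (begin
  shift j (shift 1 f) (suc n)   ≡⟨ shift-shift j 1 f (suc n) ⟩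
  shift (j + 1) f (suc n)       ≡⟨ cong (λ r → shift r f (suc n)) (ℕ.+-comm j 1) ⟩
  shift (1 + j) f (suc n)       ∎))

-- Both sides are the coefficient of xⁿ in (1 + x)ᵖ ∑ⱼ X j xʲ.
D-convolution : ∀ {B} p n X → n < B → p ≤ n → ∑< B (λ j → shift j (λ M → + (p C M)) n ℤ.* X j) ≡ D p X (n ∸ p)
D-convolution zero n X n<B _ = pick n X n<B
  where
  pick : ∀ {B} n X → n < B → ∑< B (λ j → shift j (λ M → + (0 C M)) n ℤ.* X j) ≡ X n
  pick {suc B} zero X _ = trans
    (cong₂ ℤ._+_ (ℤ.*-identityˡ (X 0)) (∑<-zero B (λ _ _ → refl))) (ℤ.+-identityʳ (X 0))
  pick {suc B} (suc n) X (s≤s n<B) = trans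
    (cong₂ ℤ._+_ (cong (λ x → + x ℤ.* X 0) (k>n⇒nCk≡0 {0} {suc n} (s≤s z≤n))) (pick n (X ∘ suc) n<B)) (ℤ.+-identityˡ (X (suc n)))
D-convolution {B} (suc p) (suc n) X n<B (s≤s p≤n) = begin
  ∑< B (λ j → shift j (λ M → + (suc p C M)) (suc n) ℤ.* X j)
    ≡⟨ ∑<-cong B (λ j _ → trans
         (cong (ℤ._* X j) (trans (shift-cong j (suc n) (λ M _ → pascal M)) (shift-suc j n C′)))
         (ℤ.*-distribʳ-+ (X j) (shift j C′ (suc n)) (shift j C′ n))) ⟩
  ∑< B (λ j → shift j C′ (suc n) ℤ.* X j ℤ.+ shift j C′ n ℤ.* X j)
    ≡⟨ ∑<-+ B (λ j → shift j C′ (suc n) ℤ.* X j) (λ j → shift j C′ n ℤ.* X j) ⟩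
  ∑< B (λ j → shift j C′ (suc n) ℤ.* X j) ℤ.+ ∑< B (λ j → shift j C′ n ℤ.* X j)
    ≡⟨ cong₂ ℤ._+_ (D-convolution p (suc n) X n<B (ℕ.m≤n⇒m≤1+n p≤n)) (D-convolution p n X (ℕ.<-trans (ℕ.n<1+n n) n<B) p≤n) ⟩
  D p X (suc n ∸ p) ℤ.+ D p X (n ∸ p)
    ≡⟨ ℤ.+-comm (D p X (suc n ∸ p)) _ ⟩
  D p X (n ∸ p) ℤ.+ D p X (suc n ∸ p)
    ≡⟨ cong (λ s → D p X (n ∸ p) ℤ.+ D p X s) (ℕ.+-∸-assoc 1 p≤n) ⟩
  D p X (n ∸ p) ℤ.+ D p X (suc (n ∸ p)) ∎
  where
  C′ : ℕ → ℤ
  C′ M = + (p C M)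
  pascal : ∀ M → + (suc p C M) ≡ C′ M ℤ.+ shift 1 C′ M
  pascal zero    = trans (cong +_ (C-0 (suc p))) (sym (trans (ℤ.+-identityʳ (C′ 0)) (cong +_ (C-0 p))))
  pascal (suc M) = cong +_ (trans (C-suc p M) (ℕ.+-comm (p C M) _))

-- The rule (1 + z)ᵖ (1 + z)ᵗ = (1 + z)ᵖ⁺ᵗ, with the powers of z multiplied along.
D-D : ∀ p t c s u → D p (λ j → D t c (j + s)) u ≡ D (p + t) c (u + s)
D-D zero    t c s u = refl
D-D (suc p) t c s u = cong₂ ℤ._+_ (D-D p t c s u) (D-D p t c s (suc u))

D-+ : ∀ t c j s → D t (λ i → c (j + i)) s ≡ D t c (j + s)
D-+ zero    c j s = refl
D-+ (suc t) c j s = cong₂ ℤ._+_ (D-+ t c j s) (trans (D-+ t c j (suc s)) (cong (D t c) (ℕ.+-suc j s)))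

κ-weight : ∀ {k} → Vector ℕ k → Vector ℕ k → ℤ
κ-weight n p = ∏ℤ (λ i → -1ℤ ^ (n i + p i) ℤ.* + κ (n i) (p i))

-- From g = x (1 + z) / (1 + z x), the coefficient of xⁿ in gᵖ is (-1)^(n-p) binom(n-1, p-1) z^(n-p)
-- (1 + z)ᵖ. Over all letters the exponents of z and of 1 + z add up, which leaves a single `D` and
-- no sum over j.
T₀-∑box : ∀ {k} B Φ (n : Vector ℕ k) c → (∀ i → 1 ≤ n i) → (∀ i → n i < B) →
  T 0 B Φ n c ≡ ∑box (λ _ → 1) n (λ p → Φ p ℤ.* κ-weight n p ℤ.* D (∑ℕ p) c (∑ℕ (λ i → n i ∸ p i)))
T₀-∑box {zero}  B Φ n c 1≤n n<B = cong (ℤ._* c 0) (sym (ℤ.*-identityʳ (Φ Vector.[])))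
T₀-∑box {suc k} B Φ n c 1≤n n<B = trans (K-∑range 0 B n₀ X (1≤n zero) (n<B zero))
  (∑range-cong 1 n₀ (λ p _ p≤n₀ → slice p p≤n₀))
  where
  n₀ : ℕ
  n₀ = head n
  t : Vector ℕ k
  t = tail n
  X : ℕ → ℕ → ℤ
  X p j = T 0 B (λ p′ → Φ (p Vector.∷ p′)) t (λ s → c (j + s))
  slice : ∀ p → p ≤ n₀ → row 0 B n₀ p (X p) ≡ ∑box (λ _ → 1) t (λ p′ → Φ (p Vector.∷ p′) ℤ.*
    (-1ℤ ^ (n₀ + p) ℤ.* + κ n₀ p ℤ.* κ-weight t p′) ℤ.* D (p + ∑ℕ p′) c (n₀ ∸ p + ∑ℕ (λ i → t i ∸ p′ i)))
  slice p p≤n₀ = begin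
    ∑< B (λ j → coeff 0 n₀ p j ℤ.* X p j)
      ≡⟨ ∑<-cong B (λ j _ → trans
           (cong₂ ℤ._*_ (coeff₀ n₀ p j) (T₀-∑box B Φ′ t (λ s → c (j + s)) (1≤n ∘ suc) (n<B ∘ suc)))
           (∑box-*ˡ (λ _ → 1) t (w ℤ.* shift j C′ n₀) (λ p′ → V p′ ℤ.* D (∑ℕ p′) (λ s → c (j + s)) (d p′)))) ⟩
    ∑< B (λ j → ∑box (λ _ → 1) t (λ p′ → w ℤ.* shift j C′ n₀ ℤ.* (V p′ ℤ.* D (∑ℕ p′) (λ s → c (j + s)) (d p′))))
      ≡⟨ ∑<-∑box B (λ _ → 1) t (λ j p′ → w ℤ.* shift j C′ n₀ ℤ.* (V p′ ℤ.* D (∑ℕ p′) (λ s → c (j + s)) (d p′))) ⟩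
    ∑box (λ _ → 1) t (λ p′ → ∑< B (λ j → w ℤ.* shift j C′ n₀ ℤ.* (V p′ ℤ.* D (∑ℕ p′) (λ s → c (j + s)) (d p′))))
      ≡⟨ ∑box-cong (λ _ → 1) t (λ p′ _ → inner p′) ⟩
    ∑box (λ _ → 1) t (λ p′ → Φ′ p′ ℤ.* (w ℤ.* κ-weight t p′) ℤ.* D (p + ∑ℕ p′) c (n₀ ∸ p + d p′)) ∎
    where
    Φ′ V : Vector ℕ k → ℤ
    Φ′ p′ = Φ (p Vector.∷ p′)
    V p′ = Φ′ p′ ℤ.* κ-weight t p′
    d : Vector ℕ k → ℕ
    d p′ = ∑ℕ (λ i → t i ∸ p′ i)
    w : ℤ
    w = -1ℤ ^ (n₀ + p) ℤ.* + κ n₀ p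
    C′ : ℕ → ℤ
    C′ M = + (p C M)
    regroup : ∀ w x y z → w ℤ.* x ℤ.* (y ℤ.* z) ≡ w ℤ.* y ℤ.* (x ℤ.* z)
    regroup = solve-∀
    reorder : ∀ w x y → w ℤ.* (x ℤ.* y) ≡ x ℤ.* (w ℤ.* y)
    reorder = solve-∀
    inner : ∀ p′ → ∑< B (λ j → w ℤ.* shift j C′ n₀ ℤ.* (V p′ ℤ.* D (∑ℕ p′) (λ s → c (j + s)) (d p′)))
            ≡ Φ′ p′ ℤ.* (w ℤ.* κ-weight t p′) ℤ.* D (p + ∑ℕ p′) c (n₀ ∸ p + d p′)
    inner p′ = begin
      ∑< B (λ j → w ℤ.* shift j C′ n₀ ℤ.* (V p′ ℤ.* D (∑ℕ p′) (λ s → c (j + s)) (d p′)))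
        ≡⟨ ∑<-cong B (λ j _ → trans
             (cong (λ x → w ℤ.* shift j C′ n₀ ℤ.* (V p′ ℤ.* x)) (D-+ (∑ℕ p′) c j (d p′)))
             (regroup w (shift j C′ n₀) (V p′) (D (∑ℕ p′) c (j + d p′)))) ⟩
      ∑< B (λ j → w ℤ.* V p′ ℤ.* (shift j C′ n₀ ℤ.* D (∑ℕ p′) c (j + d p′)))
        ≡⟨ ∑<-*ˡ B (w ℤ.* V p′) (λ j → shift j C′ n₀ ℤ.* D (∑ℕ p′) c (j + d p′)) ⟨
      w ℤ.* V p′ ℤ.* ∑< B (λ j → shift j C′ n₀ ℤ.* D (∑ℕ p′) c (j + d p′))
        ≡⟨ cong₂ ℤ._*_ (reorder w (Φ′ p′) (κ-weight t p′)) (trans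
             (D-convolution p n₀ (λ j → D (∑ℕ p′) c (j + d p′)) (n<B zero) p≤n₀)
             (D-D p (∑ℕ p′) c (d p′) (n₀ ∸ p))) ⟩
      Φ′ p′ ℤ.* (w ℤ.* κ-weight t p′) ℤ.* D (p + ∑ℕ p′) c (n₀ ∸ p + d p′) ∎

∑ℕ-∸ : ∀ {k} (n p : Vector ℕ k) → (∀ i → p i ≤ n i) → ∑ℕ n ≡ ∑ℕ p + ∑ℕ (λ i → n i ∸ p i)
∑ℕ-∸ {zero}  n p p≤n = refl
∑ℕ-∸ {suc k} n p p≤n = begin
  head n + ∑ℕ (tail n)
    ≡⟨ cong₂ _+_ (sym (ℕ.m+[n∸m]≡n (p≤n zero))) (∑ℕ-∸ (tail n) (tail p) (p≤n ∘ suc)) ⟩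
  head p + (head n ∸ head p) + (∑ℕ (tail p) + ∑ℕ (λ i → tail n i ∸ tail p i))
    ≡⟨ interchange (head p) (head n ∸ head p) (∑ℕ (tail p)) _ ⟩
  head p + ∑ℕ (tail p) + (head n ∸ head p + ∑ℕ (λ i → tail n i ∸ tail p i)) ∎

κ-weight-binom : ∀ {k} (n p : Vector ℕ k) → Box (λ _ → 1) n p →
  κ-weight n p ≡ -1ℤ ^ (∑ℕ n + ∑ℕ p) ℤ.* ∏ℤ (λ i → binom (+ n i - 1ℤ) (+ p i - 1ℤ))
κ-weight-binom {zero}  n p p∈ = refl
κ-weight-binom {suc k} n p p∈ = begin
  -1ℤ ^ (x + y) ℤ.* + κ x y ℤ.* κ-weight (tail n) (tail p)
    ≡⟨ cong₂ (λ u v → -1ℤ ^ (x + y) ℤ.* u ℤ.* v)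
         (κ-binom x y (ℕ.≤-trans (proj₁ (p∈ zero)) (proj₂ (p∈ zero))) (proj₁ (p∈ zero)))
         (κ-weight-binom (tail n) (tail p) (p∈ ∘ suc)) ⟩
  -1ℤ ^ (x + y) ℤ.* b ℤ.* (-1ℤ ^ (x′ + y′) ℤ.* Π)
    ≡⟨ regroup (-1ℤ ^ (x + y)) b (-1ℤ ^ (x′ + y′)) Π ⟩
  -1ℤ ^ (x + y) ℤ.* -1ℤ ^ (x′ + y′) ℤ.* (b ℤ.* Π)
    ≡⟨ cong (ℤ._* (b ℤ.* Π)) (ℤ.^-distribˡ-+-* -1ℤ (x + y) (x′ + y′)) ⟨
  -1ℤ ^ (x + y + (x′ + y′)) ℤ.* (b ℤ.* Π)
    ≡⟨ cong (λ e → -1ℤ ^ e ℤ.* (b ℤ.* Π)) (interchange x y x′ y′) ⟩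
  -1ℤ ^ (x + x′ + (y + y′)) ℤ.* (b ℤ.* Π) ∎
  where
  x y x′ y′ : ℕ
  x = head n
  y = head p
  x′ = ∑ℕ (tail n)
  y′ = ∑ℕ (tail p)
  b Π : ℤ
  b = binom (+ x - 1ℤ) (+ y - 1ℤ)
  Π = ∏ℤ (λ i → binom (+ tail n i - 1ℤ) (+ tail p i - 1ℤ))
  regroup : ∀ a b c d → a ℤ.* b ℤ.* (c ℤ.* d) ≡ a ℤ.* c ℤ.* (b ℤ.* d)
  regroup = solve-∀

-- For P ≤ m, the P factors y lower the threshold to m - P, and its value at d is a signed
-- binom(d-1, m-P). For P > m both sides are 0, the right one by its negative lower index.
D-threshold-binom : ∀ P d m → -1ℤ ^ (P + d + P) ℤ.* D P (threshold m) d
                    ≡ -1ℤ ^ m ℤ.* -1ℤ ^ P ℤ.* binom (+ (P + d) - + P - 1ℤ) (+ m - + P)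
D-threshold-binom P d m with P ℕ.≤? m
... | no P≰m = trans
  (trans (cong (ℤ._*_ (-1ℤ ^ (P + d + P))) (D-threshold-> P d (ℕ.≰⇒> P≰m))) (ℤ.*-zeroʳ (-1ℤ ^ (P + d + P))))
  (sym (trans (cong (ℤ._*_ (-1ℤ ^ m ℤ.* -1ℤ ^ P)) (cong (binom (+ (P + d) - + P - 1ℤ)) negative)) (ℤ.*-zeroʳ (-1ℤ ^ m ℤ.* -1ℤ ^ P))))
  where
  negative : + m - + P ≡ -[1+ P ∸ suc m ]
  negative = trans (cong (λ x → + m - + x) (sym (trans (ℕ.+-suc m (P ∸ suc m)) (ℕ.m+[n∸m]≡n (ℕ.≰⇒> P≰m))))) (neg-∸ m (P ∸ suc m))
... | yes P≤m = begin
  -1ℤ ^ (P + d + P) ℤ.* D P (threshold m) d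
    ≡⟨ cong (ℤ._*_ (-1ℤ ^ (P + d + P))) (trans (D-threshold-≤ P d P≤m) (threshold-binom v d)) ⟩
  -1ℤ ^ (P + d + P) ℤ.* (-1ℤ ^ (d + v) ℤ.* binom (+ d - 1ℤ) (+ v))
    ≡⟨ ℤ.*-assoc (-1ℤ ^ (P + d + P)) (-1ℤ ^ (d + v)) _ ⟨
  -1ℤ ^ (P + d + P) ℤ.* -1ℤ ^ (d + v) ℤ.* binom (+ d - 1ℤ) (+ v)
    ≡⟨ cong₂ ℤ._*_ signs (cong₂ (λ x y → binom (x - 1ℤ) y) (sym (pos-∸ P d)) (sym m-P≡v)) ⟩
  -1ℤ ^ m ℤ.* -1ℤ ^ P ℤ.* binom (+ (P + d) - + P - 1ℤ) (+ m - + P) ∎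
  where
  v : ℕ
  v = m ∸ P
  m≡P+v : P + v ≡ m
  m≡P+v = ℕ.m+[n∸m]≡n P≤m
  m-P≡v : + m - + P ≡ + v
  m-P≡v = trans (cong (λ x → + x - + P) (sym m≡P+v)) (pos-∸ P v)
  x y z : ℤ
  x = -1ℤ ^ P
  y = -1ℤ ^ d
  z = -1ℤ ^ v
  regroup : ∀ x y z → x ℤ.* y ℤ.* x ℤ.* (y ℤ.* z) ≡ y ℤ.* y ℤ.* (x ℤ.* z ℤ.* x)
  regroup = solve-∀
  signs : -1ℤ ^ (P + d + P) ℤ.* -1ℤ ^ (d + v) ≡ -1ℤ ^ m ℤ.* -1ℤ ^ P
  signs = begin
    -1ℤ ^ (P + d + P) ℤ.* -1ℤ ^ (d + v)
      ≡⟨ cong₂ ℤ._*_ (trans (ℤ.^-distribˡ-+-* -1ℤ (P + d) P) (cong (ℤ._* x) (ℤ.^-distribˡ-+-* -1ℤ P d))) (ℤ.^-distribˡ-+-* -1ℤ d v) ⟩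
    x ℤ.* y ℤ.* x ℤ.* (y ℤ.* z)
      ≡⟨ regroup x y z ⟩
    y ℤ.* y ℤ.* (x ℤ.* z ℤ.* x)
      ≡⟨ cong (ℤ._* (x ℤ.* z ℤ.* x)) (sign² d) ⟩
    1ℤ ℤ.* (x ℤ.* z ℤ.* x)
      ≡⟨ ℤ.*-identityˡ (x ℤ.* z ℤ.* x) ⟩
    x ℤ.* z ℤ.* x
      ≡⟨ cong (ℤ._* x) (trans (sym (ℤ.^-distribˡ-+-* -1ℤ P v)) (cong (-1ℤ ^_) m≡P+v)) ⟩
    -1ℤ ^ m ℤ.* -1ℤ ^ P ∎

Q₀-formula : ∀ {k} m (n : Vector ℕ k) → (∀ i → 1 ≤ n i) →
  + Q n 0 m ≡ -1ℤ ^ m ℤ.* ∑box (λ _ → 1) n (λ p → -1ℤ ^ ∑ℕ p ℤ.*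
    binom (+ ∑ℕ n - + ∑ℕ p - 1ℤ) (+ m - + ∑ℕ p) ℤ.* + multinomial p ℤ.*
    ∏ℤ (λ i → binom (+ n i - 1ℤ) (+ p i - 1ℤ)))
Q₀-formula m n 1≤n = begin
  + Q n 0 m                        ≡⟨ Q≡T n 0 m B (ℕ.n<1+n _) ⟩
  T 0 B multinomialℤ n (threshold m)          ≡⟨ T₀-∑box B multinomialℤ n (threshold m) 1≤n (λ i → s≤s (component≤∑ n i)) ⟩
  ∑box (λ _ → 1) n (λ p → multinomialℤ p ℤ.* κ-weight n p ℤ.* D (∑ℕ p) (threshold m) (∑ℕ (λ i → n i ∸ p i)))
    ≡⟨ ∑box-cong (λ _ → 1) n summand₀ ⟩
  ∑box (λ _ → 1) n (λ p → -1ℤ ^ m ℤ.* term p)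
    ≡⟨ ∑box-*ˡ (λ _ → 1) n (-1ℤ ^ m) term ⟨
  -1ℤ ^ m ℤ.* ∑box (λ _ → 1) n term ∎
  where
  B : ℕ
  B = suc (∑ℕ n)
  Π term : Vector ℕ _ → ℤ
  Π p = ∏ℤ (λ i → binom (+ n i - 1ℤ) (+ p i - 1ℤ))
  term p = -1ℤ ^ ∑ℕ p ℤ.* binom (+ ∑ℕ n - + ∑ℕ p - 1ℤ) (+ m - + ∑ℕ p) ℤ.* multinomialℤ p ℤ.* Π p
  left : ∀ a b c d → a ℤ.* (b ℤ.* c) ℤ.* d ≡ b ℤ.* d ℤ.* (a ℤ.* c)
  left = solve-∀
  right : ∀ a b c d e → a ℤ.* b ℤ.* c ℤ.* (d ℤ.* e) ≡ a ℤ.* (b ℤ.* c ℤ.* d ℤ.* e)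
  right = solve-∀
  summand₀ : ∀ p → Box (λ _ → 1) n p →
    multinomialℤ p ℤ.* κ-weight n p ℤ.* D (∑ℕ p) (threshold m) (∑ℕ (λ i → n i ∸ p i)) ≡ -1ℤ ^ m ℤ.* term p
  summand₀ p p∈ = begin
    multinomialℤ p ℤ.* κ-weight n p ℤ.* D P (threshold m) d
      ≡⟨ cong (λ x → multinomialℤ p ℤ.* x ℤ.* D P (threshold m) d) (κ-weight-binom n p p∈) ⟩
    multinomialℤ p ℤ.* (-1ℤ ^ (∑ℕ n + P) ℤ.* Π p) ℤ.* D P (threshold m) d
      ≡⟨ left (multinomialℤ p) (-1ℤ ^ (∑ℕ n + P)) (Π p) (D P (threshold m) d) ⟩
    -1ℤ ^ (∑ℕ n + P) ℤ.* D P (threshold m) d ℤ.* (multinomialℤ p ℤ.* Π p)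
      ≡⟨ cong (λ N → -1ℤ ^ (N + P) ℤ.* D P (threshold m) d ℤ.* (multinomialℤ p ℤ.* Π p)) ∑n≡ ⟩
    -1ℤ ^ (P + d + P) ℤ.* D P (threshold m) d ℤ.* (multinomialℤ p ℤ.* Π p)
      ≡⟨ cong (ℤ._* (multinomialℤ p ℤ.* Π p)) (D-threshold-binom P d m) ⟩
    -1ℤ ^ m ℤ.* -1ℤ ^ P ℤ.* binom (+ (P + d) - + P - 1ℤ) (+ m - + P) ℤ.* (multinomialℤ p ℤ.* Π p)
      ≡⟨ cong (λ N → -1ℤ ^ m ℤ.* -1ℤ ^ P ℤ.* binom (+ N - + P - 1ℤ) (+ m - + P) ℤ.* (multinomialℤ p ℤ.* Π p)) ∑n≡ ⟨
    -1ℤ ^ m ℤ.* -1ℤ ^ P ℤ.* binom (+ ∑ℕ n - + P - 1ℤ) (+ m - + P) ℤ.* (multinomialℤ p ℤ.* Π p)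
      ≡⟨ right (-1ℤ ^ m) (-1ℤ ^ P) (binom (+ ∑ℕ n - + P - 1ℤ) (+ m - + P)) (multinomialℤ p) (Π p) ⟩
    -1ℤ ^ m ℤ.* term p ∎
    where
    P d : ℕ
    P = ∑ℕ p
    d = ∑ℕ (λ i → n i ∸ p i)
    ∑n≡ : ∑ℕ n ≡ P + d
    ∑n≡ = ∑ℕ-∸ n p (proj₂ ∘ p∈)

theorem3 : (k : ℕ) → 1 ≤ k → (n : Vector ℕ k) → (∀ i → 1 ≤ n i) → (m : ℕ) →
    ((q : ℕ) .{{_ : NonZero q}} →
    + Q n q m ≡
    -1ℤ ^ (∑ℕ n + m) ℤ.*
    ∑box (λ _ → 1) n (λ p →
    -1ℤ ^ ∑ℕ p ℤ.* + multinomial p ℤ.*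
    ∑box (λ i → ⌈ (n i ∸ p i) / suc q ⌉) (λ i → ⌊ (n i ∸ p i) / q ⌋) (λ j →
    -1ℤ ^ (∑ℕ j * suc q) ℤ.* binom (+ ∑ℕ j - 1ℤ) (+ m) ℤ.*
    ∏ℤ (λ i →
    binom (+ n i - + (q * j i) - 1ℤ) (+ p i - 1ℤ) ℤ.*
    binom (+ p i) (+ n i - + (q * j i) - + j i)))))
    × (∑ℕ n ≤ m → Q n 0 m ≡ multinomial n)
    × (m < ∑ℕ n →
    + Q n 0 m ≡
    -1ℤ ^ m ℤ.*
    ∑box (λ _ → 1) n (λ p →
    -1ℤ ^ ∑ℕ p ℤ.*
    binom (+ ∑ℕ n - + ∑ℕ p - 1ℤ) (+ m - + ∑ℕ p) ℤ.*
    + multinomial p ℤ.*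
    ∏ℤ (λ i → binom (+ n i - 1ℤ) (+ p i - 1ℤ))))
theorem3 k 1≤k n 1≤n m =
  (λ q → Q-formula q m n 1≤n) ,
  Q-all-words n 0 m ,
  (λ _ → Q₀-formula m n 1≤n)
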